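{- Let $q$ be a fixed prime power and $k\ge 2$ a fixed integer. Let $m_1,\dots,m_k$ be positive integers with $m_1=\max_{1\le i\le k-1}m_i$. Assume that $m_1\ge 3$ when $k=2$ and that $m_1\ge 2$ when $k=3$. Then $$I_k(m_1,\dots,m_k)=N_k(m_1,\dots,m_k)-q\,N_k(m_1,\dots,m_{k-1},m_k-1)+O\bigl(q^{m_1(m_2+1)\cdots(m_k+1)}\bigr).$$
   Context: $\mathbb F_q$ is the finite field with $q$ elements. Two polynomials in $\mathbb F_q[x_1,\dots,x_k]$ are identified if they differ by a factor in $\mathbb F_q^\times$; the classes are called normalized polynomials. The vector degree of a nonzero $f$ is $\operatorname{Deg} f=(\deg_{x_1}f,\dots,\deg_{x_k}f)$. For a $k$-tuple $\mathfrak m$ of nonnegative integers, $N_k(\mathfrak m)$ is the number of normalized polynomials $f\in\mathbb F_q[x_1,\dots,x_k]$ with $\operatorname{Deg} f=\mathfrak m$, and $I_k(\mathfrak m)$ is the number of those that are irreducible. The notation $O(A(m_1,\dots,m_k))$ denotes a function $B(m_1,\dots,m_k)$ with $|B|\le C\,A$ for all $m_1,\dots,m_k$ in the described range, where $C>0$ is a constant independent of $m_1,\dots,m_k$ (it may depend on $q$ and $k$). -}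

module Defs where

open import Level using (Level; _⊔_) renaming (suc to lsuc)
open import Algebra.Bundles using (CommutativeRing; RawSemiring)
open import Data.Fin.Base using (Fin; toℕ)
open import Data.Nat.Base as ℕ using (ℕ; zero; suc; _∸_; _^_; _≤_; _<_)
import Data.Nat.Properties as ℕ
open import Data.Nat.Primality using (Prime)
open import Data.Product.Base using (∃-syntax; _×_; _,_; proj₁)
open import Data.Vec.Base using (Vec; []; _∷_; lookup; foldr′)
open import Data.Vec.Relation.Unary.Any using (Any; here; there)
open import Function.Bundles using (Inverse)
open import Relation.Binary.Bundles using (Setoid)
import Relation.Binary.Construct.On as On
open import Relation.Binary.PropositionalEquality as ≡ using (_≡_)
open import Relation.Nullary using (yes; no)
open import Relation.Unary using (Pred)

IsPrimePower : ℕ → Set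
IsPrimePower q = ∃[ p ] ∃[ r ] Prime p × 0 < r × q ≡ p ^ r

maximum : ∀ {n} → Vec ℕ n → ℕ
maximum = foldr′ ℕ._⊔_ 0

product : ∀ {n} → Vec ℕ n → ℕ
product = foldr′ ℕ._*_ 1

record FiniteField c ℓ (q : ℕ) : Set (lsuc (c ⊔ ℓ)) where
  field
    commutativeRing : CommutativeRing c ℓ

  open CommutativeRing commutativeRing public

  field
    1≉0         : 1# ≉ 0#
    inverse     : ∀ x → x ≉ 0# → ∃[ y ] x * y ≈ 1#
    enumeration : Inverse setoid (≡.setoid (Fin q))

module Polynomials {c ℓ : Level} {q : ℕ} (F : FiniteField c ℓ q) where

  open FiniteField F
  open import Algebra.Properties.Monoid.Sum +-monoid
    using (sum; sum⁺-syntax; sum-cong-≋; sum-replicate-zero)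

  -- Exponent vectors index the monomials: e stands for x₁^e₁ ⋯ xₖ^eₖ.

  Coefficients : ℕ → Set c
  Coefficients k = Vec ℕ k → Carrier

  VanishesBeyond : ∀ {k} → ℕ → Coefficients k → Set ℓ
  VanishesBeyond b f = ∀ e → Any (b <_) e → f e ≈ 0#

  -- The bound only witnesses finiteness of the support; it need not be sharp
  -- and equality of polynomials ignores it.

  record Poly (k : ℕ) : Set (c ⊔ ℓ) where
    constructor mkPoly
    field
      coeff    : Coefficients k
      bound    : ℕ
      vanishes : VanishesBeyond bound coeff

  open Poly public

  infix 4 _≈ₚ_
  _≈ₚ_ : ∀ {k} → Poly k → Poly k → Set ℓ
  f ≈ₚ g = ∀ e → coeff f e ≈ coeff g e

  slice : ∀ {k} → ℕ → Coefficients (suc k) → Coefficients k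
  slice n f e = f (n ∷ e)

  -- The coefficient of the product at e is the sum of f a * g b over all
  -- pairs with a + b = e; the recursion splits off one variable at a time.

  convolve : ∀ {k} → Coefficients k → Coefficients k → Coefficients k
  convolve f g []      = f [] * g []
  convolve f g (n ∷ e) =
    ∑[ i ≤ n ] convolve (slice (toℕ i) f) (slice (n ∸ toℕ i) g) e

  δ : ∀ {k} → Coefficients k
  δ []          = 1#
  δ (zero  ∷ e) = δ e
  δ (suc _ ∷ _) = 0#

  private

    sum-zero : ∀ {n} {t : Fin n → Carrier} → (∀ i → t i ≈ 0#) → sum t ≈ 0#
    sum-zero {n} t≈0 = trans (sum-cong-≋ t≈0) (sum-replicate-zero n)

    convolve-zeroˡ : ∀ {k} (f g : Coefficients k) →
                     (∀ e → f e ≈ 0#) → ∀ e → convolve f g e ≈ 0#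
    convolve-zeroˡ f g f≈0 []      = trans (*-congʳ (f≈0 [])) (zeroˡ _)
    convolve-zeroˡ f g f≈0 (n ∷ e) =
      sum-zero {suc n} λ i →
        convolve-zeroˡ (slice (toℕ i) f) (slice (n ∸ toℕ i) g) (λ _ → f≈0 _) e

    convolve-zeroʳ : ∀ {k} (f g : Coefficients k) →
                     (∀ e → g e ≈ 0#) → ∀ e → convolve f g e ≈ 0#
    convolve-zeroʳ f g g≈0 []      = trans (*-congˡ (g≈0 [])) (zeroʳ _)
    convolve-zeroʳ f g g≈0 (n ∷ e) =
      sum-zero {suc n} λ i →
        convolve-zeroʳ (slice (toℕ i) f) (slice (n ∸ toℕ i) g) (λ _ → g≈0 _) e

    convolve-vanishes : ∀ {k} (f g : Coefficients k) {b d} →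
                        VanishesBeyond b f → VanishesBeyond d g →
                        VanishesBeyond (b ℕ.+ d) (convolve f g)
    convolve-vanishes f g {b} {d} vf vg (n ∷ e) (here b+d<n) =
      sum-zero {suc n} term
      where
      term : ∀ (i : Fin (suc n)) →
             convolve (slice (toℕ i) f) (slice (n ∸ toℕ i) g) e ≈ 0#
      term i with b ℕ.<? toℕ i
      ... | yes b<i = convolve-zeroˡ (slice (toℕ i) f) (slice (n ∸ toℕ i) g)
                        (λ _ → vf _ (here b<i)) e
      ... | no  b≮i = convolve-zeroʳ (slice (toℕ i) f) (slice (n ∸ toℕ i) g)
                        (λ _ → vg _ (here d<n∸i)) e
        where
        d<n∸i : d < n ∸ toℕ i
        d<n∸i = ℕ.m+n≤o⇒m≤o∸n (suc d)
          (ℕ.≤-trans (ℕ.+-monoʳ-≤ (suc d) (ℕ.≮⇒≥ b≮i))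
            (≡.subst (_< n) (ℕ.+-comm b d) b+d<n))
    convolve-vanishes f g vf vg (n ∷ e) (there b+d<e) =
      sum-zero {suc n} λ i →
        convolve-vanishes (slice (toℕ i) f) (slice (n ∸ toℕ i) g)
          (λ _ b<e → vf _ (there b<e)) (λ _ d<e → vg _ (there d<e)) e b+d<e

    δ-vanishes : ∀ {k} → VanishesBeyond 0 (δ {k})
    δ-vanishes (zero  ∷ e) (there 0<e) = δ-vanishes e 0<e
    δ-vanishes (suc _ ∷ e) _           = refl

  infixl 6 _+ₚ_
  _+ₚ_ : ∀ {k} → Poly k → Poly k → Poly k
  coeff    (f +ₚ g) e = coeff f e + coeff g e
  bound    (f +ₚ g)   = bound f ℕ.+ bound g
  vanishes (f +ₚ g) e b<e = trans
    (+-cong (vanishes f e (anyMap (ℕ.m≤m+n _ _) b<e))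
            (vanishes g e (anyMap (ℕ.m≤n+m _ _) b<e)))
    (+-identityˡ 0#)
    where
    anyMap : ∀ {k b d} {e : Vec ℕ k} → b ≤ d → Any (d <_) e → Any (b <_) e
    anyMap b≤d (here d<n)  = here (ℕ.≤-<-trans b≤d d<n)
    anyMap b≤d (there d<e) = there (anyMap b≤d d<e)

  infixl 7 _*ₚ_
  _*ₚ_ : ∀ {k} → Poly k → Poly k → Poly k
  f *ₚ g = mkPoly (convolve (coeff f) (coeff g)) (bound f ℕ.+ bound g)
    (convolve-vanishes (coeff f) (coeff g) (vanishes f) (vanishes g))

  0ₚ 1ₚ : ∀ {k} → Poly k
  0ₚ = mkPoly (λ _ → 0#) 0 (λ _ _ → refl)
  1ₚ = mkPoly δ 0 δ-vanishes

  polyRawSemiring : ℕ → RawSemiring (c ⊔ ℓ) ℓ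
  polyRawSemiring k = record
    { Carrier = Poly k
    ; _≈_     = _≈ₚ_
    ; _+_     = _+ₚ_
    ; _*_     = _*ₚ_
    ; 0#      = 0ₚ
    ; 1#      = 1ₚ
    }

  -- The library notion does not list p ≉ 0 separately: 0 = 0 * 0 already
  -- violates its factorisation clause.

  Irreducible : ∀ {k} → Poly k → Set (c ⊔ ℓ)
  Irreducible {k} = R.Irreducible
    where import Algebra.Definitions.RawSemiring (polyRawSemiring k) as R

  HasDegreeIn : ∀ {k} → Fin k → Poly k → ℕ → Set ℓ
  HasDegreeIn i f d =
    (∃[ e ] lookup e i ≡ d × coeff f e ≉ 0#) ×
    (∀ e → coeff f e ≉ 0# → lookup e i ≤ d)

  -- For k ≥ 1 this forces f to be nonzero.

  HasDeg : ∀ {k} → Vec ℕ k → Poly k → Set ℓ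
  HasDeg m f = ∀ i → HasDegreeIn i f (lookup m i)

  infix 4 _∼_
  _∼_ : ∀ {k} → Poly k → Poly k → Set (c ⊔ ℓ)
  f ∼ g = ∃[ u ] u ≉ 0# × (∀ e → coeff f e ≈ u * coeff g e)

  private

    *-≉0 : ∀ {u v} → u ≉ 0# → v ≉ 0# → u * v ≉ 0#
    *-≉0 {u} {v} u≉0 v≉0 uv≈0 with inverse v v≉0
    ... | w , vw≈1 = u≉0 (trans (sym (*-identityʳ u)) (trans
      (*-congˡ (sym vw≈1)) (trans (sym (*-assoc u v w)) (trans
      (*-congʳ uv≈0) (zeroˡ w)))))

    ∼-refl : ∀ {k} {f : Poly k} → f ∼ f
    ∼-refl = 1# , 1≉0 , λ e → sym (*-identityˡ _)

    ∼-sym : ∀ {k} {f g : Poly k} → f ∼ g → g ∼ f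
    ∼-sym (u , u≉0 , f≈ug) with inverse u u≉0
    ... | w , uw≈1 =
      w ,
      (λ w≈0 → 1≉0 (trans (sym uw≈1) (trans (*-congˡ w≈0) (zeroʳ u)))) ,
      λ e → trans (sym (*-identityˡ _)) (trans
        (*-congʳ (trans (sym uw≈1) (*-comm u w))) (trans
        (*-assoc w u _) (*-congˡ (sym (f≈ug e)))))

    ∼-trans : ∀ {k} {f g h : Poly k} → f ∼ g → g ∼ h → f ∼ h
    ∼-trans (u , u≉0 , f≈ug) (v , v≉0 , g≈vh) =
      u * v , *-≉0 u≉0 v≉0 ,
      λ e → trans (f≈ug e) (trans (*-congˡ (g≈vh e)) (sym (*-assoc u v _)))

  normalizedSetoid : ℕ → Setoid (c ⊔ ℓ) (c ⊔ ℓ)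
  normalizedSetoid k = record
    { Carrier       = Poly k
    ; _≈_           = _∼_
    ; isEquivalence = record
      { refl  = λ {f} → ∼-refl {f = f}
      ; sym   = λ {f} {g} → ∼-sym {f = f} {g}
      ; trans = λ {f} {g} {h} → ∼-trans {f = f} {g} {h}
      }
    }

  -- n is the number of ∼-classes of polynomials satisfying P (a property that
  -- should be invariant under ∼).  Elements are compared by their underlying
  -- polynomials only, so proofs of P are not counted.

  NumberOfNormalized : ∀ {k p} → Pred (Poly k) p → ℕ → Set (c ⊔ ℓ ⊔ p)
  NumberOfNormalized {k} P n =
    Inverse (On.setoid (normalizedSetoid k) (proj₁ {B = P})) (≡.setoid (Fin n))

  IsN : ∀ {k} → Vec ℕ k → ℕ → Set (c ⊔ ℓ)
  IsN m = NumberOfNormalized (HasDeg m)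

  IsI : ∀ {k} → Vec ℕ k → ℕ → Set (c ⊔ ℓ)
  IsI m = NumberOfNormalized λ f → HasDeg m f × Irreducible f

open Polynomials public using (IsN; IsI)

{-# OPTIONS --safe #-}

-- Let x be the last variable, and call f primitive if no nonconstant polynomial
-- in x alone divides it.  Every f is u g for a unique monic u in F[x] and a
-- unique primitive g.  If u is nonconstant, write u = x u′ + a: then
-- f ↦ (a , u′ g) is a bijection from the classes that are not primitive onto
-- F × {classes of degree one less in x}.  Hence exactly N - q N′ classes are
-- primitive, and the irreducible ones are among them.  A primitive reducible f
-- is a product of two polynomials neither of which lies in F[x].  Up to a swap
-- their degrees a and b = m - a satisfy
--   ∏ (aᵢ + 1) + ∏ (bᵢ + 1) + Σ aᵢ ≤ m₁ (m₂ + 1) ⋯ (mₖ + 1) + 4,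
-- so the number of these products is bounded by a geometric series in each aᵢ.

module Submission where

-- Put M = m₁ ∏ (mᵢ + 1) over 1 < i < k, so that the error term is q ^ (M (mₖ + 1)). For factors
-- whose degrees in the first k - 1 variables have box sizes u and v, the bound on the number of
-- pairs is q ^ (u (j + 1) + v (l + 1)), where j + l = mₖ. The danger is the sum over j. If M = 2,
-- as for k = 2 with m₁ = 2 or for k = 3 with m₁ = m₂ = 1, then u = v = 2 occurs, all mₖ + 1 values
-- of j give the same exponent 2 (mₖ + 2), and their sum exceeds every constant multiple of the
-- error term. The lower bounds on m₁ for k = 2 and k = 3 enter only through 3 ≤ M, which lets the
-- exponent absorb the weights of a geometric series in j. The maximality of m₁ makes M equal to the
-- largest of the fractions mᵢ / (mᵢ + 1), i < k, times the box size of the first k - 1 degrees. The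
-- set of primitive classes is never counted by itself. Two injections give I + q N′ ≤ N ≤ I + L + q
-- N′, where L is the length of a list of products. Such a list only has to cover the reducible
-- primitive polynomials and may repeat itself.

open import Defs
open import Level using (Level; _⊔_)
open import Algebra.Bundles using (CommutativeRing)
import Algebra.Definitions.RawMagma as RawMagma
import Algebra.Definitions.RawSemiring as RawSemiring
open import Data.Empty using (⊥-elim)
open import Data.Fin.Base as Fin using (Fin; toℕ; fromℕ<; funToFin; finToFun)
import Data.Fin.Properties as Fin
open import Data.List.Base as List
  using (List; []; _∷_; concatMap; length; deduplicate; cartesianProductWith)
open import Data.List.Membership.Propositional using (_∈_; find)
open import Data.List.Membership.Propositional.Properties
  using (∈-lookup; ∈-map⁺; ∈-concatMap⁺)
import Data.List.Properties as List
import Data.List.Relation.Unary.All as ListAll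
open import Data.List.Relation.Unary.AllPairs using (AllPairs; []; _∷_)
open import Data.List.Relation.Unary.Any as ListAny using (here; there; index)
import Data.List.Relation.Unary.Any.Properties as ListAny
open import Data.List.Relation.Unary.Enumerates.Setoid using (IsEnumeration)
open import Data.List.Relation.Unary.Enumerates.Setoid.Properties using (deduplicate⁺)
open import Data.List.Relation.Unary.Unique.DecSetoid.Properties using (deduplicate-!)
open import Data.Nat.Base as ℕ using (ℕ; zero; suc; _^_; _≤_; _<_; z≤n; s≤s)
import Data.Nat.ListAction as ListSum
import Data.Nat.ListAction.Properties as ListSum
open import Data.Nat.Primality using (prime⇒nonTrivial)
import Data.Nat.Properties as ℕ
open import Data.Nat.Tactic.RingSolver using (solve-∀)
open import Data.Product.Base using (∃-syntax; _×_; _,_; proj₁; proj₂)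
open import Data.Product.Properties using (,-injective)
open import Data.Sum.Base using (_⊎_; inj₁; inj₂; [_,_]′)
open import Data.Sum.Function.Propositional using (_⊎-↔_)
open import Data.Sum.Properties using (inj₁-injective; inj₂-injective)
open import Data.Vec.Base as Vec
  using ( Vec; []; _∷_; _∷ʳ_; lookup; insertAt; removeAt; zipWith; tabulate; replicate
        ; initLast; init; sum; map)
open import Data.Vec.Properties as Vec
  using ( insertAt-lookup; insertAt-removeAt; lookup-zipWith; lookup∘tabulate; lookup-replicate
        ; zipWith-comm; ∷ʳ-injective; ∷ʳ-injectiveʳ; init-∷ʳ)
open import Data.Vec.Relation.Binary.Pointwise.Extensional using (ext; extensional⇒inductive)
open import Data.Vec.Relation.Binary.Pointwise.Inductive using (Pointwise-≡⇒≡)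
open import Data.Vec.Relation.Unary.All using (All; []; _∷_)
open import Data.Vec.Relation.Unary.Any using (Any; here; there)
open import Function.Bundles using (Inverse; Injection; _↔_)
open import Function.Properties.Inverse
  using (↔-refl; ↔-sym; ↔-trans; ↔⇒↣)
open import Relation.Binary.Bundles using (Setoid; DecSetoid)
import Relation.Binary.Construct.On as On
open import Relation.Binary.Definitions using (Decidable; tri<; tri≈; tri>)
open import Relation.Binary.PropositionalEquality as ≡ using (_≡_)
open import Relation.Nullary using (¬_; Dec; yes; no)
open import Relation.Nullary.Decidable using (map′; ¬?; decidable-stable; _×-dec_)
open import Relation.Unary using (Pred)

-- Inequalities for degree vectors

module _ where

  open import Data.Nat.Base
  open import Data.Nat.Properties
  open import Relation.Binary.PropositionalEquality

  -- The number of exponent vectors bounded by `m`, so q ^ `boxSize m` counts the polynomials with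
  -- degrees at most `m`.
  boxSize : ∀ {n} → Vec ℕ n → ℕ
  boxSize m = product (map suc m)

  infixl 6 _⊕_
  _⊕_ : ∀ {n} → Vec ℕ n → Vec ℕ n → Vec ℕ n
  _⊕_ = zipWith _+_

  1≤boxSize : ∀ {n} (m : Vec ℕ n) → 1 ≤ boxSize m
  1≤boxSize []      = ≤-refl
  1≤boxSize (x ∷ m) = *-mono-≤ {1} {suc x} (s≤s z≤n) (1≤boxSize m)

  sum<boxSize : ∀ {n} (m : Vec ℕ n) → sum m < boxSize m
  sum<boxSize []      = ≤-refl
  sum<boxSize (x ∷ m) = begin
    suc (x + sum m)          ≡⟨ +-suc x (sum m) ⟨
    x + suc (sum m)          ≤⟨ +-mono-≤ (m≤m*n x (boxSize m) {{>-nonZero (1≤boxSize m)}})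
      (sum<boxSize m) ⟩
    x * boxSize m + boxSize m ≡⟨ +-comm (x * boxSize m) _ ⟩
    suc x * boxSize m        ∎
    where open ≤-Reasoning

  boxSize-sum≡0 : ∀ {n} (m : Vec ℕ n) → sum m ≡ 0 → boxSize m ≡ 1
  boxSize-sum≡0 []         _ = refl
  boxSize-sum≡0 (zero ∷ m) e = trans (+-identityʳ _) (boxSize-sum≡0 m e)

  ⊕-sum≡0ˡ : ∀ {n} (a b : Vec ℕ n) → sum a ≡ 0 → a ⊕ b ≡ b
  ⊕-sum≡0ˡ []         []      _ = refl
  ⊕-sum≡0ˡ (zero ∷ a) (x ∷ b) e = cong (x ∷_) (⊕-sum≡0ˡ a b e)

  ⊕-comm : ∀ {n} (a b : Vec ℕ n) → a ⊕ b ≡ b ⊕ a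
  ⊕-comm = zipWith-comm +-comm

  -- K / (K + 1) bounds every mᵢ / (mᵢ + 1), where m = a ⊕ b; the denominator is
  -- multiplied out.
  boxSize-⊕-bound : ∀ {n} K (a b : Vec ℕ n) → All (_≤ K) (a ⊕ b) → 0 < sum a → 0 < sum b →
    suc K * (boxSize a + boxSize b) ≤ K * boxSize (a ⊕ b) + 2 * suc K

  private
    -- One summand is (x, 0, ..., 0), and Z is the box size of the tail of the other. Since x ≥ 1,
    -- splitting 2 off x + 1 leaves x - 1 ≤ (x - 1) Z, hence at most (x + y) Z in all. Finally (K +
    -- 1)(x + y) ≤ K (x + y + 1) because x + y ≤ K.
    one-full : ∀ K x y Z → 1 ≤ Z → x + y ≤ K → 0 < x →
               suc K * (suc x * 1 + suc y * Z) ≤ K * (suc (x + y) * Z) + 2 * suc K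
    one-full K x@(suc x′) y Z 1≤Z x+y≤K _ = begin
      suc K * (suc x * 1 + suc y * Z) ≡⟨ e₁ K x′ y Z ⟩
      suc K * (x′ * 1 + suc y * Z) + 2 * suc K ≤⟨ +-monoˡ-≤ (2 * suc K)
        (*-monoʳ-≤ (suc K) (+-monoˡ-≤ (suc y * Z) (*-monoʳ-≤ x′ 1≤Z))) ⟩
      suc K * (x′ * Z + suc y * Z) + 2 * suc K ≡⟨ e₂ K x′ y Z ⟩
      K * ((x + y) * Z) + (x + y) * Z + 2 * suc K ≤⟨ +-monoˡ-≤ (2 * suc K)
        (+-monoʳ-≤ (K * ((x + y) * Z)) (*-monoˡ-≤ Z x+y≤K)) ⟩
      K * ((x + y) * Z) + K * Z + 2 * suc K ≡⟨ e₃ K (x + y) Z ⟩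
      K * (suc (x + y) * Z) + 2 * suc K ∎
      where
      open ≤-Reasoning
      e₁ : ∀ K x′ y Z →
           suc K * (suc (suc x′) * 1 + suc y * Z) ≡ suc K * (x′ * 1 + suc y * Z) + 2 * suc K
      e₁ = solve-∀
      e₂ : ∀ K x′ y Z → suc K * (x′ * Z + suc y * Z) + 2 * suc K ≡
           K * ((suc x′ + y) * Z) + (suc x′ + y) * Z + 2 * suc K
      e₂ = solve-∀
      e₃ : ∀ K s Z → K * (s * Z) + K * Z + 2 * suc K ≡ K * (suc s * Z) + 2 * suc K
      e₃ = solve-∀

  boxSize-⊕-bound K (x ∷ a) (y ∷ b) (x+y≤K ∷ a+b≤K) 0<a 0<b with sum a ≟ 0 | sum b ≟ 0
  ... | yes a≡0 | _ rewrite ⊕-sum≡0ˡ a b a≡0 | boxSize-sum≡0 a a≡0 | a≡0 =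
    one-full K x y (boxSize b) (1≤boxSize b) x+y≤K (subst (0 <_) (+-identityʳ x) 0<a)
  ... | no _ | yes b≡0
    rewrite ⊕-comm a b | ⊕-sum≡0ˡ b a b≡0 | boxSize-sum≡0 b b≡0 | b≡0 | +-comm x y
          | +-comm (suc x * boxSize a) (suc y * 1) =
    one-full K y x (boxSize a) (1≤boxSize a) x+y≤K (subst (0 <_) (+-identityʳ y) 0<b)
  ... | no a≢0 | no b≢0 = begin
    suc K * (suc x * X + suc y * Y)                   ≡⟨ e₁ K x y X Y ⟩
    suc K * (X + Y) + (x * (suc K * X) + y * (suc K * Y))
      ≤⟨ +-mono-≤ IH (+-mono-≤ (*-monoʳ-≤ x X≤) (*-monoʳ-≤ y Y≤)) ⟩
    K * Z + 2 * suc K + (x * (K * Z) + y * (K * Z))   ≡⟨ e₂ K x y Z ⟩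
    K * (suc (x + y) * Z) + 2 * suc K                 ∎
    where
    open ≤-Reasoning
    X = boxSize a
    Y = boxSize b
    Z = boxSize (a ⊕ b)
    0<Σa = n≢0⇒n>0 a≢0
    0<Σb = n≢0⇒n>0 b≢0
    IH : suc K * (X + Y) ≤ K * Z + 2 * suc K
    IH = boxSize-⊕-bound K a b a+b≤K 0<Σa 0<Σb
    -- When both tails are nonzero, each box size is at least 2, and omitting one of them pays for
    -- the constant 2 (K + 1). The x further copies of X and the y further copies of Y therefore add
    -- no new constants.
    drop : ∀ {X Y} → 2 ≤ Y → suc K * (X + Y) ≤ K * Z + 2 * suc K → suc K * X ≤ K * Z
    drop {X} {Y} 2≤Y h = +-cancelʳ-≤ (2 * suc K) _ _ (begin
      suc K * X + 2 * suc K     ≡⟨ cong (suc K * X +_) (*-comm 2 (suc K)) ⟩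
      suc K * X + suc K * 2     ≤⟨ +-monoʳ-≤ (suc K * X) (*-monoʳ-≤ (suc K) 2≤Y) ⟩
      suc K * X + suc K * Y     ≡⟨ *-distribˡ-+ (suc K) X Y ⟨
      suc K * (X + Y)           ≤⟨ h ⟩
      K * Z + 2 * suc K         ∎)
    X≤ = drop {X} {Y} (≤-trans (s≤s 0<Σb) (sum<boxSize b)) IH
    Y≤ = drop {Y} {X} (≤-trans (s≤s 0<Σa) (sum<boxSize a))
           (subst (λ s → suc K * s ≤ K * Z + 2 * suc K) (+-comm X Y) IH)
    e₁ : ∀ K x y X Y → suc K * (suc x * X + suc y * Y) ≡
         suc K * (X + Y) + (x * (suc K * X) + y * (suc K * Y))
    e₁ = solve-∀
    e₂ : ∀ K x y Z → K * Z + 2 * suc K + (x * (K * Z) + y * (K * Z)) ≡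
         K * (suc (x + y) * Z) + 2 * suc K
    e₂ = solve-∀

  -- Controls the weight `sum a` that the geometric series adds to the exponent: up to 1, it fits
  -- into what `boxSize b` leaves of the fraction K / (K + 1) of the whole box.
  boxSize-⊕-sum-bound : ∀ {n} K (a b : Vec ℕ n) → All (_≤ K) (a ⊕ b) → 0 < sum a →
    suc K * (boxSize b + sum a) ≤ K * boxSize (a ⊕ b) + suc K
  boxSize-⊕-sum-bound K (x ∷ a) (y ∷ b) (x+y≤K ∷ a+b≤K) 0<a with sum a ≟ 0
  boxSize-⊕-sum-bound K (zero ∷ a) (y ∷ b) (x+y≤K ∷ a+b≤K) 0<a | yes a≡0 =
    ⊥-elim (<⇒≢ 0<a (sym a≡0))
  boxSize-⊕-sum-bound K (suc x ∷ a) (y ∷ b) (x+y≤K ∷ a+b≤K) 0<a | yes a≡0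
    rewrite ⊕-sum≡0ˡ a b a≡0 | a≡0 = begin
    suc K * (suc y * Z + (suc x + 0))               ≡⟨ e₁ K x y Z ⟩
    suc K * (suc y * Z + x * 1) + suc K         ≤⟨ +-monoˡ-≤ (suc K)
      (*-monoʳ-≤ (suc K) (+-monoʳ-≤ (suc y * Z) (*-monoʳ-≤ x (1≤boxSize b)))) ⟩
    suc K * (suc y * Z + x * Z) + suc K         ≡⟨ e₂ K x y Z ⟩
    K * ((suc x + y) * Z) + (suc x + y) * Z + suc K  ≤⟨ +-monoˡ-≤ (suc K)
      (+-monoʳ-≤ (K * ((suc x + y) * Z)) (*-monoˡ-≤ Z x+y≤K)) ⟩
    K * ((suc x + y) * Z) + K * Z + suc K           ≡⟨ e₃ K (suc x + y) Z ⟩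
    K * (suc (suc x + y) * Z) + suc K               ∎
    where
    open ≤-Reasoning
    Z = boxSize b
    e₁ : ∀ K x y Z → suc K * (suc y * Z + (suc x + 0)) ≡ suc K * (suc y * Z + x * 1) + suc K
    e₁ = solve-∀
    e₂ : ∀ K x y Z →
         suc K * (suc y * Z + x * Z) + suc K ≡ K * ((suc x + y) * Z) + (suc x + y) * Z + suc K
    e₂ = solve-∀
    e₃ : ∀ K s Z → K * (s * Z) + K * Z + suc K ≡ K * (suc s * Z) + suc K
    e₃ = solve-∀
  boxSize-⊕-sum-bound K (x ∷ a) (y ∷ b) (x+y≤K ∷ a+b≤K) 0<a | no a≢0 = go (sum a) (n≢0⇒n>0 a≢0) IH
    where
    open ≤-Reasoning
    Y = boxSize b
    Z = boxSize (a ⊕ b)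
    IH : suc K * (Y + sum a) ≤ K * Z + suc K
    IH = boxSize-⊕-sum-bound K a b a+b≤K (n≢0⇒n>0 a≢0)
    e₁ : ∀ K x y Y s → suc K * (suc y * Y + (x + suc s)) ≡ suc K * (suc y * Y + x * 1 + s) + suc K
    e₁ = solve-∀
    e₂ : ∀ K x y Y s →
         suc K * (suc y * Y + x * Y + s) + suc K + suc K * ((x + y) * s) ≡
         suc (x + y) * (suc K * (Y + s)) + suc K
    e₂ = solve-∀
    e₃ : ∀ K s Z → s * (K * Z) + suc K ≡ K * (s * Z) + suc K
    e₃ = solve-∀
    go : ∀ s → 0 < s → suc K * (Y + s) ≤ K * Z + suc K →
         suc K * (suc y * Y + (x + s)) ≤ K * (suc (x + y) * Z) + suc K
    go (suc s) _ h = begin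
      suc K * (suc y * Y + (x + suc s))            ≡⟨ e₁ K x y Y s ⟩
      suc K * (suc y * Y + x * 1 + s) + suc K
        ≤⟨ +-monoˡ-≤ (suc K)
          (*-monoʳ-≤ (suc K) (+-monoˡ-≤ s (+-monoʳ-≤ (suc y * Y) (*-monoʳ-≤ x (1≤boxSize b))))) ⟩
      suc K * (suc y * Y + x * Y + s) + suc K      ≤⟨ m≤m+n _ (suc K * ((x + y) * s)) ⟩
      suc K * (suc y * Y + x * Y + s) + suc K + suc K * ((x + y) * s) ≡⟨ e₂ K x y Y s ⟩
      suc (x + y) * (suc K * (Y + s)) + suc K      ≤⟨ +-monoˡ-≤ (suc K)
        (*-monoʳ-≤ (suc (x + y)) h′) ⟩
      suc (x + y) * (K * Z) + suc K                ≡⟨ e₃ K (suc (x + y)) Z ⟩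
      K * (suc (x + y) * Z) + suc K                ∎
      where
      -- One unit of the sum pays for the constant of the induction hypothesis, so multiplying by
      -- `suc (x + y)` does not multiply that constant.
      h′ : suc K * (Y + s) ≤ K * Z
      h′ = +-cancelʳ-≤ (suc K) _ _
        (≤-trans (≤-reflexive
          (trans (+-comm _ (suc K))
            (trans (sym (*-suc (suc K) (Y + s))) (cong (suc K *_) (sym (+-suc Y s)))))) h)

  boxSize-∷ʳ : ∀ {n} (m : Vec ℕ n) x → boxSize (m ∷ʳ x) ≡ boxSize m * suc x
  boxSize-∷ʳ []      x = *-comm (suc x) 1
  boxSize-∷ʳ (y ∷ m) x rewrite boxSize-∷ʳ m x = sym (*-assoc (suc y) (boxSize m) (suc x))

  sum-∷ʳ : ∀ {n} (m : Vec ℕ n) x → sum (m ∷ʳ x) ≡ sum m + x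
  sum-∷ʳ []      x = +-identityʳ x
  sum-∷ʳ (y ∷ m) x rewrite sum-∷ʳ m x = sym (+-assoc y (sum m) x)

  private
    -- Here u ≤ v are the box sizes of the two prefixes, s is the degree sum of the smaller one, v +
    -- t = M, and j, l are the degrees in the last variable. Each unit of j adds 1 to the weight.
    -- This is paid for by v - u if that is positive and by t otherwise. The constant 4 is attained
    -- for u = v = 3, t = 1, s = 2, l = 0 and all j ≥ 1, that is, for k = 2, m₁ = 4 and both factors
    -- of degree 2 in the first variable.
    exponent-arith : ∀ u v t s j l → u ≤ v → u ≤ t + 2 → s ≤ t + 1 → 3 ≤ v + t → 1 ≤ j + l →
      u * suc j + v * suc l + (s + j) ≤ (v + t) * suc (j + l) + 4
    exponent-arith u v t s zero (suc l) u≤v u≤ s≤ 3≤ _ = begin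
      u * 1 + v * suc (suc l) + (s + 0)     ≡⟨ cong₂ _+_
        (cong (_+ v * suc (suc l)) (*-identityʳ u)) (+-identityʳ s) ⟩
      u + v * suc (suc l) + s     ≤⟨ +-mono-≤ (+-monoˡ-≤ (v * suc (suc l)) u≤) s≤ ⟩
      t + 2 + v * suc (suc l) + (t + 1) ≤⟨ m≤m+n _ (t * l + 1) ⟩
      t + 2 + v * suc (suc l) + (t + 1) + (t * l + 1) ≡⟨ e t v l ⟩
      (v + t) * suc (suc l) + 4 ∎
      where
      open ≤-Reasoning
      e : ∀ t v l → t + 2 + v * suc (suc l) + (t + 1) + (t * l + 1) ≡ (v + t) * suc (suc l) + 4
      e = solve-∀
    exponent-arith u v t s (suc j) l u≤v u≤ s≤ 3≤ _ = begin
      u * suc (suc j) + v * suc l + (s + suc j)     ≡⟨ e₁ u v s j l ⟩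
      u + s + (u * suc j + suc j) + v * suc l     ≤⟨ +-monoˡ-≤ (v * suc l)
        (+-mono-≤ (+-mono-≤ u≤ s≤) key) ⟩
      t + 2 + (t + 1) + (v * suc j + 1 + t * (j + l)) + v * suc l ≡⟨ e₂ v t j l ⟩
      (v + t) * suc (suc (j + l)) + 4 ∎
      where
      open ≤-Reasoning
      e₁ : ∀ u v s j l →
           u * suc (suc j) + v * suc l + (s + suc j) ≡ u + s + (u * suc j + suc j) + v * suc l
      e₁ = solve-∀
      e₂ : ∀ v t j l →
           t + 2 + (t + 1) + (v * suc j + 1 + t * (j + l)) + v * suc l ≡
           (v + t) * suc (suc (j + l)) + 4
      e₂ = solve-∀
      e₃ : ∀ u j → u * suc j + suc j ≡ suc u * suc j
      e₃ = solve-∀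
      key : u * suc j + suc j ≤ v * suc j + 1 + t * (j + l)
      key with m≤n⇒m<n∨m≡n u≤v
      ... | inj₁ u<v = begin
        u * suc j + suc j ≡⟨ e₃ u j ⟩
        suc u * suc j     ≤⟨ *-monoˡ-≤ (suc j) u<v ⟩
        v * suc j         ≤⟨ m≤m+n _ 1 ⟩
        v * suc j + 1     ≤⟨ m≤m+n _ _ ⟩
        v * suc j + 1 + t * (j + l) ∎
      ... | inj₂ refl = begin
        u * suc j + suc j               ≡⟨ e₄ u j ⟩
        u * suc j + 1 + 1 * j           ≤⟨ +-monoʳ-≤ (u * suc j + 1) (*-mono-≤ 1≤t (m≤m+n j l)) ⟩
        u * suc j + 1 + t * (j + l)     ∎
        where
        e₄ : ∀ u j → u * suc j + suc j ≡ u * suc j + 1 + 1 * j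
        e₄ = solve-∀
        -- This is where 3 ≤ M acts: for u = v and t = 0 the other bound would give u ≤ 2, and
        -- nothing would be left to pay for the weight j.
        positive : ∀ t → u ≤ t + 2 → 3 ≤ u + t → 1 ≤ t
        positive zero    u≤2 3≤u = ⊥-elim (<⇒≱ 3≤u (≤-trans (≤-reflexive (+-identityʳ u)) u≤2))
        positive (suc _) _   _   = s≤s z≤n
        1≤t : 1 ≤ t
        1≤t = positive t u≤ 3≤

  -- Summing over all (a , b) costs only a constant factor because of the
  -- summand sum a.
  exponent-bound : ∀ {r} m₁ (ms : Vec ℕ r) (a b : Vec ℕ (suc r)) j l →
    a ⊕ b ≡ m₁ ∷ ms → All (_≤ m₁) (m₁ ∷ ms) → 3 ≤ m₁ * boxSize ms → 1 ≤ j + l →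
    0 < sum a → 0 < sum b → boxSize a ≤ boxSize b →
    boxSize (a ∷ʳ j) + boxSize (b ∷ʳ l) + sum (a ∷ʳ j) ≤ m₁ * boxSize (ms ∷ʳ (j + l)) + 4
  exponent-bound m₁ ms a b j l eq m≤ 3≤M 1≤j+l 0<a 0<b u≤v
    rewrite boxSize-∷ʳ a j | boxSize-∷ʳ b l | sum-∷ʳ a j | boxSize-∷ʳ ms (j + l)
          | sym (*-assoc m₁ (boxSize ms) (suc (j + l))) =
    subst (λ M → boxSize a * suc j + boxSize b * suc l + (sum a + j) ≤ M * suc (j + l) + 4)
      (m+[n∸m]≡n v≤M)
      (exponent-arith (boxSize a) (boxSize b) (M ∸ boxSize b) (sum a) j l u≤v
        (shift _ 2 (≤-trans (≤-reflexive (+-comm (boxSize b) _)) u+v≤)) (shift _ 1 v+s≤)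
          (subst (3 ≤_) (sym (m+[n∸m]≡n v≤M)) 3≤M) 1≤j+l)
    where
    M = m₁ * boxSize ms
    e : ∀ K Z c → K * (suc K * Z) + c * suc K ≡ suc K * (K * Z + c)
    e = solve-∀
    m≤′ : All (_≤ m₁) (a ⊕ b)
    m≤′ = subst (All (_≤ m₁)) (sym eq) m≤
    u+v≤ : boxSize a + boxSize b ≤ M + 2
    u+v≤ = *-cancelˡ-≤ (suc m₁) (≤-trans (boxSize-⊕-bound m₁ a b m≤′ 0<a 0<b)
      (≤-reflexive (trans (cong (λ m → m₁ * boxSize m + 2 * suc m₁) eq) (e m₁ (boxSize ms) 2))))
    v+s≤ : boxSize b + sum a ≤ M + 1
    v+s≤ = *-cancelˡ-≤ (suc m₁) (≤-trans (boxSize-⊕-sum-bound m₁ a b m≤′ 0<a)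
      (≤-reflexive
        (trans (cong₂ (λ m c → m₁ * boxSize m + c) eq (sym (*-identityˡ (suc m₁))))
          (e m₁ (boxSize ms) 1))))
    v≤M : boxSize b ≤ M
    v≤M = +-cancelʳ-≤ 1 (boxSize b) M (≤-trans (+-monoʳ-≤ (boxSize b) 0<a) v+s≤)
    shift : ∀ s c → boxSize b + s ≤ M + c → s ≤ M ∸ boxSize b + c
    shift s c h = +-cancelˡ-≤ (boxSize b) s _ (≤-trans h (≤-reflexive
      (trans (cong (_+ c) (sym (m+[n∸m]≡n v≤M))) (+-assoc (boxSize b) _ c))))

  power-bound : ∀ {q E} x y s → 2 ≤ q → x + y + s ≤ E → q ^ x * q ^ y * 2 ^ s ≤ q ^ E
  power-bound {q} {E} x y s 2≤q x+y+s≤E = begin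
    q ^ x * q ^ y * 2 ^ s ≤⟨ *-monoʳ-≤ (q ^ x * q ^ y) (^-monoˡ-≤ s 2≤q) ⟩
    q ^ x * q ^ y * q ^ s ≡⟨ cong (_* q ^ s) (^-distribˡ-+-* q x y) ⟨
    q ^ (x + y) * q ^ s   ≡⟨ ^-distribˡ-+-* q (x + y) s ⟨
    q ^ (x + y + s)       ≤⟨ ^-monoʳ-≤ q {{>-nonZero (<⇒≤ 2≤q)}} x+y+s≤E ⟩
    q ^ E                 ∎
    where open ≤-Reasoning

  All-≤-maximum : ∀ {n} (m : Vec ℕ n) → All (_≤ maximum m) m
  All-≤-maximum []      = []
  All-≤-maximum (x ∷ m) = m≤m⊔n x _ ∷ weaken (All-≤-maximum m)
    where
    weaken : ∀ {k} {v : Vec ℕ k} → All (_≤ maximum m) v → All (_≤ x ℕ.⊔ maximum m) v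
    weaken []       = []
    weaken (p ∷ ps) = ≤-trans p (m≤n⊔m x _) ∷ weaken ps

  -- Splittings of a degree vector and geometric sums over them

  splitsℕ : ℕ → List (ℕ × ℕ)
  splitsℕ zero    = (0 , 0) ∷ []
  splitsℕ (suc n) = (0 , suc n) ∷ List.map (λ (i , j) → suc i , j) (splitsℕ n)

  splits : ∀ {n} → Vec ℕ n → List (Vec ℕ n × Vec ℕ n)
  splits []      = ([] , []) ∷ []
  splits (n ∷ m) =
    concatMap (λ (i , j) → List.map (λ (a , b) → i ∷ a , j ∷ b) (splits m)) (splitsℕ n)

  total : ∀ {a} {A : Set a} → (A → ℕ) → List A → ℕ
  total g xs = ListSum.sum (List.map g xs)

  total-++ : ∀ {a} {A : Set a} (g : A → ℕ) xs ys → total g (xs List.++ ys) ≡ total g xs + total g ys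
  total-++ g xs ys = trans (cong ListSum.sum (List.map-++ g xs ys))
    (ListSum.sum-++ (List.map g xs) (List.map g ys))

  total-map : ∀ {a b} {A : Set a} {B : Set b} (g : B → ℕ) (f : A → B) xs →
              total g (List.map f xs) ≡ total (λ x → g (f x)) xs
  total-map g f xs = cong ListSum.sum (sym (List.map-∘ xs))

  total-concatMap : ∀ {a b} {A : Set a} {B : Set b} (g : B → ℕ) (f : A → List B) xs →
                    total g (concatMap f xs) ≡ total (λ x → total g (f x)) xs
  total-concatMap g f []       = refl
  total-concatMap g f (x ∷ xs) = trans (total-++ g (f x) (concatMap f xs))
                                       (cong (total g (f x) +_) (total-concatMap g f xs))

  total-*ˡ : ∀ {a} {A : Set a} c (g : A → ℕ) xs → total (λ x → c * g x) xs ≡ c * total g xs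
  total-*ˡ c g []       = sym (*-zeroʳ c)
  total-*ˡ c g (x ∷ xs) = trans (cong (c * g x +_) (total-*ˡ c g xs)) (sym (*-distribˡ-+ c (g x) _))

  length-concatMap : ∀ {a b} {A : Set a} {B : Set b} (f : A → List B) xs →
                     length (concatMap f xs) ≡ total (λ x → length (f x)) xs
  length-concatMap f []       = refl
  length-concatMap f (x ∷ xs) =
    trans (List.length-++ (f x)) (cong (length (f x) +_) (length-concatMap f xs))

  -- A geometric series: the term at i is at most K / 2 ^ i. Removing the first term and doubling
  -- `g` restores the hypothesis with the same K, so the rest contributes at most K again.
  total-splitsℕ : ∀ n K (g : ℕ × ℕ → ℕ) → (∀ i j → i + j ≡ n → g (i , j) * 2 ^ i ≤ K) →
                  total g (splitsℕ n) ≤ 2 * K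
  total-splitsℕ zero    K g h = ≤-trans
    (≤-reflexive (trans (+-identityʳ _) (sym (*-identityʳ _)))) (≤-trans (h 0 0 refl) (m≤m+n K _))
  total-splitsℕ (suc n) K g h = +-mono-≤
    {g (0 , suc n)} {K} {total g (List.map shift (splitsℕ n))} {K + 0}
    (≤-trans (≤-reflexive (sym (*-identityʳ _))) (h 0 (suc n) refl))
    (≤-trans
      (*-cancelˡ-≤ 2 (≤-trans
        (≤-reflexive (trans (cong (2 *_) (total-map g shift (splitsℕ n)))
          (sym (total-*ˡ 2 (λ ij → g (shift ij)) (splitsℕ n)))))
        (total-splitsℕ n K (λ ij → 2 * g (shift ij))
          λ i j i+j≡n → ≤-trans (≤-reflexive (e (g (suc i , j)) (2 ^ i)))
            (h (suc i) j (cong suc i+j≡n)))))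
      (≤-reflexive (sym (+-identityʳ K))))
    where
    shift : ℕ × ℕ → ℕ × ℕ
    shift (i , j) = suc i , j
    e : ∀ x y → 2 * x * y ≡ x * (2 * y)
    e = solve-∀

  -- The weight 2 ^ i of the first variable is absorbed into g, which leaves the
  -- hypothesis for the other variables.
  total-splits : ∀ {n} (m : Vec ℕ n) K (g : Vec ℕ n × Vec ℕ n → ℕ) →
                 (∀ a b → a ⊕ b ≡ m → g (a , b) * 2 ^ sum a ≤ K) → total g (splits m) ≤ 2 ^ n * K
  total-splits []      K g h = ≤-trans
    (≤-reflexive (trans (+-identityʳ _) (sym (*-identityʳ _)))) (≤-trans (h [] [] refl) (m≤m+n K 0))
  total-splits {suc k} (n ∷ m) K g h = begin
    total g (splits (n ∷ m))
      ≡⟨ total-concatMap g _ (splitsℕ n) ⟩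
    total (λ (i , j) → total g (List.map (λ (a , b) → i ∷ a , j ∷ b) (splits m))) (splitsℕ n)
      ≤⟨ total-splitsℕ n (2 ^ k * K) _ (λ i j i+j≡n → begin
        total g (List.map (λ (a , b) → i ∷ a , j ∷ b) (splits m)) * 2 ^ i
          ≡⟨ *-comm _ (2 ^ i) ⟩
        2 ^ i * total g (List.map (λ (a , b) → i ∷ a , j ∷ b) (splits m))
          ≡⟨ cong (2 ^ i *_) (total-map g _ (splits m)) ⟩
        2 ^ i * total (λ (a , b) → g (i ∷ a , j ∷ b)) (splits m)
          ≡⟨ total-*ˡ (2 ^ i) _ (splits m) ⟨
        total (λ (a , b) → 2 ^ i * g (i ∷ a , j ∷ b)) (splits m)
          ≤⟨ total-splits m K _ (λ a b a⊕b≡m → begin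
            2 ^ i * g (i ∷ a , j ∷ b) * 2 ^ sum a    ≡⟨ e (2 ^ i) _ (2 ^ sum a) ⟩
            g (i ∷ a , j ∷ b) * (2 ^ i * 2 ^ sum a)  ≡⟨ cong (g (i ∷ a , j ∷ b) *_)
              (^-distribˡ-+-* 2 i (sum a)) ⟨
            g (i ∷ a , j ∷ b) * 2 ^ (i + sum a)      ≤⟨ h (i ∷ a) (j ∷ b) (cong₂ _∷_ i+j≡n a⊕b≡m) ⟩
            K                                        ∎) ⟩
        2 ^ k * K ∎) ⟩
    2 * (2 ^ k * K) ≡⟨ *-assoc 2 (2 ^ k) K ⟨
    2 ^ suc k * K ∎
    where
    open ≤-Reasoning
    e : ∀ x y z → x * y * z ≡ y * (x * z)
    e = solve-∀

  ∈-splitsℕ : ∀ i j → (i , j) ∈ splitsℕ (i + j)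
  ∈-splitsℕ zero    zero    = here refl
  ∈-splitsℕ zero    (suc j) = here refl
  ∈-splitsℕ (suc i) j       = there (∈-map⁺ _ (∈-splitsℕ i j))

  ∈-splits : ∀ {n} (a b : Vec ℕ n) → (a , b) ∈ splits (a ⊕ b)
  ∈-splits []      []      = here refl
  ∈-splits (i ∷ a) (j ∷ b) = ∈-concatMap⁺ _
    (ListAny.map (λ { refl → ∈-map⁺ _ (∈-splits a b) }) (∈-splitsℕ i j))

-- Vectors, lists and the number of classes of a finite setoid

lookup-injective : ∀ {a} {A : Set a} {n} {v w : Vec A n} → (∀ i → lookup v i ≡ lookup w i) → v ≡ w
lookup-injective v≗w = Pointwise-≡⇒≡ (extensional⇒inductive (ext v≗w))

greatest : ∀ {p} {P : Pred ℕ p} → (∀ n → Dec (P n)) → ∀ N → (∃[ n ] n < N × P n) →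
           ∃[ d ] P d × (∀ n → n < N → P n → n ≤ d)
greatest P? (suc N) (n , n<1+N , Pn) with P? N
... | yes PN = N , PN , λ n n<1+N _ → ℕ.<⇒≤pred n<1+N
... | no ¬PN =
  proj₁ rec , proj₁ (proj₂ rec) , λ n n<1+N Pn → proj₂ (proj₂ rec) n (below n<1+N Pn) Pn
  where
  below : ∀ {n} → n < suc N → _ → n < N
  below n<1+N Pn = ℕ.≤∧≢⇒< (ℕ.<⇒≤pred n<1+N) λ { ≡.refl → ¬PN Pn }
  rec = greatest P? N (n , below n<1+N Pn , Pn)

Any-insertAt : ∀ {p n} {P : Pred ℕ p} {e : Vec ℕ n} i j → Any P e → Any P (insertAt e i j)
Any-insertAt Fin.zero    j a         = there a
Any-insertAt (Fin.suc i) j (here p)  = here p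
Any-insertAt (Fin.suc i) j (there a) = there (Any-insertAt i j a)

insertAt-Any : ∀ {p n} {P : Pred ℕ p} (e : Vec ℕ n) i {j} → P j → Any P (insertAt e i j)
insertAt-Any e       Fin.zero    p = here p
insertAt-Any (x ∷ e) (Fin.suc i) p = there (insertAt-Any e i p)

AllPairs-lookup : ∀ {a r} {A : Set a} {R : A → A → Set r} {xs : List A} → AllPairs R xs →
                  ∀ i j → i Fin.< j → R (List.lookup xs i) (List.lookup xs j)
AllPairs-lookup (rs ∷ _)  Fin.zero    (Fin.suc j) _   = ListAll.lookup rs (∈-lookup j)
AllPairs-lookup (_ ∷ ps)  (Fin.suc i) (Fin.suc j) i<j = AllPairs-lookup ps i j (ℕ.s<s⁻¹ i<j)

-- A list meeting every class, possibly repeatedly, becomes a list of exact representatives after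
-- deduplication. The position of the representative then numbers the class.
enumeration⇒count : ∀ {a ℓ} (DS : DecSetoid a ℓ) {xs : List (DecSetoid.Carrier DS)} →
                    IsEnumeration (DecSetoid.setoid DS) xs →
                    ∃[ n ] Inverse (DecSetoid.setoid DS) (≡.setoid (Fin n))
enumeration⇒count DS {xs} enum = length ys , record
  { to        = λ x → index (enum′ x)
  ; from      = List.lookup ys
  ; to-cong   = λ {x} {y} x≈y → lookup-injective′
      (trans (sym (ListAny.lookup-index (enum′ x))) (trans x≈y (ListAny.lookup-index (enum′ y))))
  ; from-cong = λ { ≡.refl → refl }
  ; inverse   =
      (λ {i} {x} x≈yᵢ → lookup-injective′ (trans (sym (ListAny.lookup-index (enum′ x))) x≈yᵢ)) ,
      (λ { {x} ≡.refl → sym (ListAny.lookup-index (enum′ x)) })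
  }
  where
  open DecSetoid DS
  ys = deduplicate _≟_ xs
  enum′ : IsEnumeration setoid ys
  enum′ = deduplicate⁺ DS enum
  distinct = AllPairs-lookup (deduplicate-! DS xs)
  lookup-injective′ : ∀ {i j} → List.lookup ys i ≈ List.lookup ys j → i ≡ j
  lookup-injective′ {i} {j} yᵢ≈yⱼ with Fin.<-cmp i j
  ... | tri< i<j _ _ = ⊥-elim (distinct i j i<j yᵢ≈yⱼ)
  ... | tri≈ _ i≡j _ = i≡j
  ... | tri> _ _ j<i = ⊥-elim (distinct j i j<i (sym yᵢ≈yⱼ))

lookup-⊕ : ∀ {n} (a b : Vec ℕ n) i → lookup (a ⊕ b) i ≡ lookup a i ℕ.+ lookup b i
lookup-⊕ a b i = Vec.lookup-zipWith ℕ._+_ i a b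

replicate-∷ʳ-⊕ : ∀ {p} (b : Vec ℕ p) s t → (replicate p 0 ∷ʳ s) ⊕ (b ∷ʳ t) ≡ b ∷ʳ (s ℕ.+ t)
replicate-∷ʳ-⊕ []      s t = ≡.refl
replicate-∷ʳ-⊕ (x ∷ b) s t = ≡.cong (x ∷_) (replicate-∷ʳ-⊕ b s t)

replicate-∷ʳ : ∀ p {a} {A : Set a} (x : A) → replicate p x ∷ʳ x ≡ replicate (suc p) x
replicate-∷ʳ zero    x = ≡.refl
replicate-∷ʳ (suc p) x = ≡.cong (x ∷_) (replicate-∷ʳ p x)

lookup-∷ʳ-mono : ∀ {p} (v : Vec ℕ p) {s t} → s ≤ t → ∀ i → lookup (v ∷ʳ s) i ≤ lookup (v ∷ʳ t) i
lookup-∷ʳ-mono []      s≤t Fin.zero    = s≤t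
lookup-∷ʳ-mono (x ∷ v) s≤t Fin.zero    = ℕ.≤-refl
lookup-∷ʳ-mono (x ∷ v) s≤t (Fin.suc i) = lookup-∷ʳ-mono v s≤t i

⊕-∷ʳ : ∀ {n} (a b : Vec ℕ n) j l → (a ∷ʳ j) ⊕ (b ∷ʳ l) ≡ (a ⊕ b) ∷ʳ (j ℕ.+ l)
⊕-∷ʳ []      []      j l = ≡.refl
⊕-∷ʳ (x ∷ a) (y ∷ b) j l = ≡.cong (x ℕ.+ y ∷_) (⊕-∷ʳ a b j l)

sum≡0⇒replicate : ∀ {n} (a : Vec ℕ n) → sum a ≡ 0 → a ≡ replicate n 0
sum≡0⇒replicate []         _   = ≡.refl
sum≡0⇒replicate (zero ∷ a) a≡0 = ≡.cong (0 ∷_) (sum≡0⇒replicate a a≡0)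

length-cartesianProductWith : ∀ {a b c} {A : Set a} {B : Set b} {C : Set c} (f : A → B → C) xs ys →
                              length (cartesianProductWith f xs ys) ≡ length xs ℕ.* length ys
length-cartesianProductWith f []       ys = ≡.refl
length-cartesianProductWith f (x ∷ xs) ys = ≡.trans (List.length-++ (List.map (f x) ys))
  (≡.cong₂ ℕ._+_ (List.length-map (f x) ys) (length-cartesianProductWith f xs ys))

-- Polynomials over a finite field

module OverFiniteField {c ℓ : Level} {q : ℕ} (F : FiniteField c ℓ q) where

  open FiniteField F hiding (zero)
  open Polynomials F hiding (IsN; IsI)
  open import Algebra.Properties.CommutativeSemigroup +-commutativeSemigroup
    using (interchange; x∙yz≈y∙xz)
  open import Algebra.Properties.Group using (x∙y⁻¹≈ε⇒x≈y; x≈y⇒x∙y⁻¹≈ε)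
  open import Algebra.Properties.Monoid.Sum +-monoid using (sum-cong-≋)
  open import Algebra.Properties.Ring using (-‿distribʳ-*; -0#≈0#)
  open import Algebra.Properties.Semiring.Sum semiring using (*-distribˡ-sum)
  open import Relation.Binary.Reasoning.Setoid setoid

  -- Ring laws of the convolution product

  infix 4 _≋_
  _≋_ : ∀ {k} → Coefficients k → Coefficients k → Set ℓ
  f ≋ g = ∀ e → f e ≈ g e

  infixl 6 _⊞_
  _⊞_ : ∀ {k} → Coefficients k → Coefficients k → Coefficients k
  (f ⊞ g) e = f e + g e

  -- Splitting off the first summand gives, definitionally,
  --   (f g)ₙ₊₁ = f₀ gₙ₊₁ + (shift f · g)ₙ,
  -- the recursion behind the ring laws below.
  shift : ∀ {k} → Coefficients (suc k) → Coefficients (suc k)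
  shift f (n ∷ e) = f (suc n ∷ e)

  convolve-cong : ∀ {k} {f f′ g g′ : Coefficients k} → f ≋ f′ → g ≋ g′ →
                  convolve f g ≋ convolve f′ g′
  convolve-cong f≋ g≋ []      = *-cong (f≋ []) (g≋ [])
  convolve-cong f≋ g≋ (n ∷ e) =
    sum-cong-≋ {suc n} λ i → convolve-cong (λ e → f≋ (toℕ i ∷ e)) (λ e → g≋ (n ℕ.∸ toℕ i ∷ e)) e

  convolve-zeroˡ : ∀ {k} (f g : Coefficients k) → (∀ e → f e ≈ 0#) → ∀ e → convolve f g e ≈ 0#
  convolve-zeroˡ f g f≈0 [] = trans (*-congʳ (f≈0 [])) (zeroˡ _)
  convolve-zeroˡ f g f≈0 (zero ∷ e) =
    trans (+-identityʳ _) (convolve-zeroˡ (slice 0 f) (slice 0 g) (λ _ → f≈0 _) e)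
  convolve-zeroˡ f g f≈0 (suc n ∷ e) = trans
    (+-cong (convolve-zeroˡ (slice 0 f) (slice (suc n) g) (λ _ → f≈0 _) e)
            (convolve-zeroˡ (shift f) g (λ { (_ ∷ _) → f≈0 _ }) (n ∷ e)))
    (+-identityʳ 0#)

  convolve-distribʳ : ∀ {k} (f g h : Coefficients k) →
                      convolve (f ⊞ g) h ≋ convolve f h ⊞ convolve g h
  convolve-distribʳ f g h []         = distribʳ _ _ _
  convolve-distribʳ f g h (zero ∷ e) = begin
    convolve (slice 0 (f ⊞ g)) (slice 0 h) e + 0#
      ≈⟨ +-cong (convolve-distribʳ (slice 0 f) (slice 0 g) (slice 0 h) e) (sym (+-identityʳ 0#)) ⟩
    convolve (slice 0 f) (slice 0 h) e + convolve (slice 0 g) (slice 0 h) e + (0# + 0#)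
      ≈⟨ interchange _ _ _ _ ⟩
    convolve f h (zero ∷ e) + convolve g h (zero ∷ e) ∎
  convolve-distribʳ f g h (suc n ∷ e) = begin
    convolve (slice 0 (f ⊞ g)) (slice (suc n) h) e + convolve (shift (f ⊞ g)) h (n ∷ e)
      ≈⟨ +-cong (convolve-distribʳ (slice 0 f) (slice 0 g) (slice (suc n) h) e)
           (trans (convolve-cong {f = shift (f ⊞ g)} {shift f ⊞ shift g} {h}
             (λ { (_ ∷ _) → refl }) (λ _ → refl) (n ∷ e))
                  (convolve-distribʳ (shift f) (shift g) h (n ∷ e))) ⟩
    convolve (slice 0 f) (slice (suc n) h) e + convolve (slice 0 g) (slice (suc n) h) e
      + (convolve (shift f) h (n ∷ e) + convolve (shift g) h (n ∷ e))
      ≈⟨ interchange _ _ _ _ ⟩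
    convolve f h (suc n ∷ e) + convolve g h (suc n ∷ e) ∎

  -- The mirror image of the defining recursion, with the last summand split off. Commutativity
  -- follows by comparing the two recursions.
  convolve-sucʳ : ∀ {k} (f g : Coefficients (suc k)) n e →
    convolve f g (suc n ∷ e) ≈
    convolve (slice (suc n) f) (slice 0 g) e + convolve f (shift g) (n ∷ e)
  convolve-sucʳ f g zero e = begin
    convolve (slice 0 f) (slice 1 g) e + (convolve (slice 1 f) (slice 0 g) e + 0#)
      ≈⟨ x∙yz≈y∙xz _ _ _ ⟩
    convolve (slice 1 f) (slice 0 g) e + (convolve (slice 0 f) (slice 1 g) e + 0#) ∎
  convolve-sucʳ f g (suc n) e = begin
    convolve (slice 0 f) (slice (2 ℕ.+ n) g) e + convolve (shift f) g (suc n ∷ e)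
      ≈⟨ +-congˡ (convolve-sucʳ (shift f) g n e) ⟩
    convolve (slice 0 f) (slice (2 ℕ.+ n) g) e
      + (convolve (slice (2 ℕ.+ n) f) (slice 0 g) e + convolve (shift f) (shift g) (n ∷ e))
      ≈⟨ x∙yz≈y∙xz _ _ _ ⟩
    convolve (slice (2 ℕ.+ n) f) (slice 0 g) e + convolve f (shift g) (suc n ∷ e) ∎

  convolve-comm : ∀ {k} (f g : Coefficients k) → convolve f g ≋ convolve g f
  convolve-comm f g []          = *-comm _ _
  convolve-comm f g (zero ∷ e)  = +-congʳ (convolve-comm (slice 0 f) (slice 0 g) e)
  convolve-comm f g (suc n ∷ e) = begin
    convolve (slice 0 f) (slice (suc n) g) e + convolve (shift f) g (n ∷ e)
      ≈⟨ +-cong (convolve-comm (slice 0 f) (slice (suc n) g) e)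
        (convolve-comm (shift f) g (n ∷ e)) ⟩
    convolve (slice (suc n) g) (slice 0 f) e + convolve g (shift f) (n ∷ e)
      ≈⟨ convolve-sucʳ g f n e ⟨
    convolve g f (suc n ∷ e) ∎

  convolve-distribˡ : ∀ {k} (f g h : Coefficients k) →
                      convolve f (g ⊞ h) ≋ convolve f g ⊞ convolve f h
  convolve-distribˡ f g h e = begin
    convolve f (g ⊞ h) e            ≈⟨ convolve-comm f (g ⊞ h) e ⟩
    convolve (g ⊞ h) f e            ≈⟨ convolve-distribʳ g h f e ⟩
    convolve g f e + convolve h f e ≈⟨ +-cong (convolve-comm g f e) (convolve-comm h f e) ⟩
    convolve f g e + convolve f h e ∎

  -- Proved together with `⊙-assoc`. Pointwise, `shift (convolve f g)` is `slice 0 f ⊙ shift g ⊞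
  -- convolve (shift f) g`, so the step requires associativity when the first factor does not
  -- contain the first variable. That case reduces to `convolve-assoc` in one variable fewer.
  convolve-assoc : ∀ {k} (f g h : Coefficients k) →
                   convolve (convolve f g) h ≋ convolve f (convolve g h)

  private
    infixl 7 _⊙_
    _⊙_ : ∀ {k} → Coefficients k → Coefficients (suc k) → Coefficients (suc k)
    (a ⊙ g) (n ∷ e) = convolve a (slice n g) e

    ⊙-assoc : ∀ {k} (a : Coefficients k) (g h : Coefficients (suc k)) n e →
              convolve (a ⊙ g) h (n ∷ e) ≈ convolve a (slice n (convolve g h)) e
    ⊙-assoc a g h zero e = begin
      convolve (convolve a (slice 0 g)) (slice 0 h) e + 0#
        ≈⟨ +-identityʳ _ ⟩
      convolve (convolve a (slice 0 g)) (slice 0 h) e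
        ≈⟨ convolve-assoc a (slice 0 g) (slice 0 h) e ⟩
      convolve a (convolve (slice 0 g) (slice 0 h)) e
        ≈⟨ convolve-cong {f = a} (λ _ → refl) (λ _ → sym (+-identityʳ _)) e ⟩
      convolve a (slice 0 (convolve g h)) e ∎
    ⊙-assoc a g h (suc n) e = begin
      convolve (convolve a (slice 0 g)) (slice (suc n) h) e + convolve (shift (a ⊙ g)) h (n ∷ e)
        ≈⟨ +-cong (convolve-assoc a (slice 0 g) (slice (suc n) h) e)
             (trans (convolve-cong {f = shift (a ⊙ g)} {a ⊙ shift g} {h} (λ { (_ ∷ _) → refl })
               (λ _ → refl) (n ∷ e))
                    (⊙-assoc a (shift g) h n e)) ⟩
      convolve a (convolve (slice 0 g) (slice (suc n) h)) e
        + convolve a (slice n (convolve (shift g) h)) e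
        ≈⟨ convolve-distribˡ a (convolve (slice 0 g) (slice (suc n) h))
          (slice n (convolve (shift g) h)) e ⟨
      convolve a (slice (suc n) (convolve g h)) e ∎

  convolve-assoc f g h []         = *-assoc _ _ _
  convolve-assoc f g h (zero ∷ e) = +-congʳ (begin
    convolve (slice 0 (convolve f g)) (slice 0 h) e
      ≈⟨ convolve-cong {g = slice 0 h} (λ _ → +-identityʳ _) (λ _ → refl) e ⟩
    convolve (convolve (slice 0 f) (slice 0 g)) (slice 0 h) e
      ≈⟨ convolve-assoc (slice 0 f) (slice 0 g) (slice 0 h) e ⟩
    convolve (slice 0 f) (convolve (slice 0 g) (slice 0 h)) e
      ≈⟨ convolve-cong {f = slice 0 f} (λ _ → refl) (λ _ → sym (+-identityʳ _)) e ⟩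
    convolve (slice 0 f) (slice 0 (convolve g h)) e ∎)
  convolve-assoc f g h (suc n ∷ e) = begin
    convolve (slice 0 (convolve f g)) (slice (suc n) h) e
      + convolve (shift (convolve f g)) h (n ∷ e)
      ≈⟨ +-cong
           (trans (convolve-cong {g = slice (suc n) h} (λ _ → +-identityʳ _) (λ _ → refl) e)
                  (convolve-assoc (slice 0 f) (slice 0 g) (slice (suc n) h) e))
           (trans (convolve-cong {f = shift (convolve f g)}
             {slice 0 f ⊙ shift g ⊞ convolve (shift f) g} {h}
                    (λ { (_ ∷ _) → refl }) (λ _ → refl) (n ∷ e))
                  (convolve-distribʳ (slice 0 f ⊙ shift g) (convolve (shift f) g) h (n ∷ e))) ⟩
    convolve (slice 0 f) (convolve (slice 0 g) (slice (suc n) h)) e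
      + (convolve (slice 0 f ⊙ shift g) h (n ∷ e) + convolve (convolve (shift f) g) h (n ∷ e))
      ≈⟨ +-congˡ
        (+-cong (⊙-assoc (slice 0 f) (shift g) h n e) (convolve-assoc (shift f) g h (n ∷ e))) ⟩
    convolve (slice 0 f) (convolve (slice 0 g) (slice (suc n) h)) e
      + (convolve (slice 0 f) (slice n (convolve (shift g) h)) e
        + convolve (shift f) (convolve g h) (n ∷ e))
      ≈⟨ +-assoc _ _ _ ⟨
    convolve (slice 0 f) (convolve (slice 0 g) (slice (suc n) h)) e
      + convolve (slice 0 f) (slice n (convolve (shift g) h)) e
      + convolve (shift f) (convolve g h) (n ∷ e)
      ≈⟨ +-congʳ (convolve-distribˡ (slice 0 f) (convolve (slice 0 g) (slice (suc n) h))
                   (slice n (convolve (shift g) h)) e) ⟨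
    convolve f (convolve g h) (suc n ∷ e) ∎

  convolve-identityˡ : ∀ {k} (f : Coefficients k) → convolve δ f ≋ f
  convolve-identityˡ f []          = *-identityˡ _
  convolve-identityˡ f (zero ∷ e)  = trans (+-identityʳ _) (convolve-identityˡ (slice 0 f) e)
  convolve-identityˡ f (suc n ∷ e) = trans
    (+-cong (convolve-identityˡ (slice (suc n) f) e)
            (convolve-zeroˡ (shift δ) f (λ { (_ ∷ _) → refl }) (n ∷ e)))
    (+-identityʳ _)

  infix 8 -ₚ_
  -ₚ_ : ∀ {k} → Poly k → Poly k
  -ₚ f = mkPoly (λ e → - coeff f e) (bound f) λ e b<e →
    trans (-‿cong (vanishes f e b<e)) (-0#≈0# ring)

  -- _≈ₚ_ and HasDeg unfold to statements from which Agda cannot recover the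
  -- polynomials (their bounds do not occur); the wrappers keep them inferable.

  infix 4 _≃_
  record _≃_ {k} (f g : Poly k) : Set ℓ where
    constructor ≃⁺
    field ≃⁻ : f ≈ₚ g

  record Deg {k} (m : Vec ℕ k) (f : Poly k) : Set ℓ where
    constructor deg⁺
    field deg⁻ : HasDeg m f

  open _≃_ public
  open Deg public

  polyRing : ℕ → CommutativeRing (c ⊔ ℓ) ℓ
  polyRing k = record
    { Carrier = Poly k
    ; _≈_     = _≃_
    ; _+_     = _+ₚ_
    ; _*_     = _*ₚ_
    ; -_      = -ₚ_
    ; 0#      = 0ₚ
    ; 1#      = 1ₚ
    ; isCommutativeRing = record
      { isRing = record
        { +-isAbelianGroup = record
          { isGroup = record
            { isMonoid = record
              { isSemigroup = record
                { isMagma = record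
                  { isEquivalence = record
                    { refl  = ≃⁺ λ _ → refl
                    ; sym   = λ (≃⁺ p) → ≃⁺ λ e → sym (p e)
                    ; trans = λ (≃⁺ p) (≃⁺ r) → ≃⁺ λ e → trans (p e) (r e)
                    }
                  ; ∙-cong = λ (≃⁺ p) (≃⁺ r) → ≃⁺ λ e → +-cong (p e) (r e)
                  }
                ; assoc = λ _ _ _ → ≃⁺ λ _ → +-assoc _ _ _
                }
              ; identity = (λ _ → ≃⁺ λ _ → +-identityˡ _) , (λ _ → ≃⁺ λ _ → +-identityʳ _)
              }
            ; inverse = (λ _ → ≃⁺ λ _ → -‿inverseˡ _) , (λ _ → ≃⁺ λ _ → -‿inverseʳ _)
            ; ⁻¹-cong = λ (≃⁺ p) → ≃⁺ λ e → -‿cong (p e)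
            }
          ; comm = λ _ _ → ≃⁺ λ _ → +-comm _ _
          }
        ; *-cong     = λ (≃⁺ p) (≃⁺ r) → ≃⁺ (convolve-cong p r)
        ; *-assoc    = λ f g h → ≃⁺ (convolve-assoc (coeff f) (coeff g) (coeff h))
        ; *-identity =
            (λ f → ≃⁺ (convolve-identityˡ (coeff f))) ,
            (λ f → ≃⁺ λ e → trans (convolve-comm (coeff f) δ e) (convolve-identityˡ (coeff f) e))
        ; distrib    =
            (λ f g h → ≃⁺ (convolve-distribˡ (coeff f) (coeff g) (coeff h))) ,
            (λ f g h → ≃⁺ (convolve-distribʳ (coeff g) (coeff h) (coeff f)))
        }
      ; *-comm = λ f g → ≃⁺ (convolve-comm (coeff f) (coeff g))
      }
    }

  -- Degrees

  infix 4 _≟_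
  _≟_ : Decidable _≈_
  x ≟ y = map′
    (λ tx≡ty → trans (sym (strictlyInverseʳ x)) (trans (from-cong tx≡ty) (strictlyInverseʳ y)))
    to-cong (to x Fin.≟ to y)
    where open Inverse enumeration

  *-≉0 : ∀ {u v} → u ≉ 0# → v ≉ 0# → u * v ≉ 0#
  *-≉0 {u} {v} u≉0 v≉0 uv≈0 with inverse v v≉0
  ... | w , vw≈1 = u≉0 (begin
    u           ≈⟨ *-identityʳ u ⟨
    u * 1#      ≈⟨ *-congˡ vw≈1 ⟨
    u * (v * w) ≈⟨ *-assoc u v w ⟨
    u * v * w   ≈⟨ *-congʳ uv≈0 ⟩
    0# * w      ≈⟨ zeroˡ w ⟩
    0#          ∎)

  convolve-zeroʳ : ∀ {k} (f g : Coefficients k) → (∀ e → g e ≈ 0#) → ∀ e → convolve f g e ≈ 0#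
  convolve-zeroʳ f g g≈0 e = trans (convolve-comm f g e) (convolve-zeroˡ g f g≈0 e)

  Nonzero : ∀ {k} → Coefficients k → Set ℓ
  Nonzero f = ∃[ e ] f e ≉ 0#

  nonzero? : ∀ {k} b (f : Coefficients k) → VanishesBeyond b f → Dec (Nonzero f)
  nonzero? {zero}  b f v = map′ ([] ,_) (λ { ([] , fe≉0) → fe≉0 }) (¬? (f [] ≟ 0#))
  nonzero? {suc k} b f v = map′
    (λ { (n , _ , e , fe≉0) → n ∷ e , fe≉0 })
    (λ { (n ∷ e , fe≉0) → n , s≤s (ℕ.≮⇒≥ λ b<n → fe≉0 (v (n ∷ e) (here b<n))) , e , fe≉0 })
    (ℕ.anyUpTo? (λ n → nonzero? b (slice n f) λ e b<e → v (n ∷ e) (there b<e)) (suc b))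

  ¬Nonzero⇒≈0 : ∀ {k} (f : Coefficients k) → ¬ Nonzero f → ∀ e → f e ≈ 0#
  ¬Nonzero⇒≈0 f ¬nz e = decidable-stable (f e ≟ 0#) λ fe≉0 → ¬nz (e , fe≉0)

  Nonzero-cong : ∀ {k} {f g : Coefficients k} → f ≋ g → Nonzero f → Nonzero g
  Nonzero-cong f≋g (e , fe≉0) = e , λ ge≈0 → fe≉0 (trans (f≋g e) ge≈0)

  at : ∀ {k} → Fin (suc k) → ℕ → Coefficients (suc k) → Coefficients k
  at i n f e = f (insertAt e i n)

  at-vanishes : ∀ {k b} i n {f : Coefficients (suc k)} → VanishesBeyond b f →
                VanishesBeyond b (at i n f)
  at-vanishes i n v e b<e = v (insertAt e i n) (Any-insertAt i n b<e)

  BoundedIn : ∀ {k} → Fin (suc k) → ℕ → Coefficients (suc k) → Set ℓ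
  BoundedIn i d f = ∀ n → d < n → ∀ e → at i n f e ≈ 0#

  convolve-top : ∀ {k} a b (f g : Coefficients (suc k)) → BoundedIn Fin.zero a f →
                 BoundedIn Fin.zero b g →
                 ∀ e → convolve f g (a ℕ.+ b ∷ e) ≈ convolve (slice a f) (slice b g) e
  convolve-top zero zero f g bf bg e = +-identityʳ _
  convolve-top zero (suc b) f g bf bg e = trans
    (+-congˡ (convolve-zeroˡ (shift f) g (λ { (n ∷ e) → bf (suc n) (s≤s z≤n) e }) (b ∷ e)))
    (+-identityʳ _)
  convolve-top (suc a) b f g bf bg e = trans
    (+-cong (convolve-zeroʳ (slice 0 f) (slice (suc (a ℕ.+ b)) g) (bg _ (s≤s (ℕ.m≤n+m b a))) e)
            (convolve-top a b (shift f) g (λ n a<n → bf (suc n) (s≤s a<n)) bg e))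
    (+-identityˡ _)

  -- Of the pairs of exponents of variable `i` with sum a + b, only (a , b) survives the two bounds.
  -- For a later variable, the sum over exponents of the first one is left untouched. Partial
  -- degrees thus become additive without reordering the variables.
  convolve-at : ∀ {k} i a b (f g : Coefficients (suc k)) → BoundedIn i a f → BoundedIn i b g →
                at i (a ℕ.+ b) (convolve f g) ≋ convolve (at i a f) (at i b g)
  convolve-at Fin.zero    a b f g bf bg e       = convolve-top a b f g bf bg e
  convolve-at (Fin.suc i) a b f g bf bg (n ∷ e) = sum-cong-≋ {suc n} λ j →
    convolve-at i a b (slice (toℕ j) f) (slice (n ℕ.∸ toℕ j) g)
      (λ m a<m e → bf m a<m (toℕ j ∷ e)) (λ m b<m e → bg m b<m (n ℕ.∸ toℕ j ∷ e)) e

  -- For n > a + b, write n = a + (n - a). As n - a > b, it is still a bound for `g`, and the slice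
  -- of `g` there vanishes, so `convolve-at` applies with this slack bound.
  convolve-bounded : ∀ {k} i a b (f g : Coefficients (suc k)) → BoundedIn i a f → BoundedIn i b g →
                     BoundedIn i (a ℕ.+ b) (convolve f g)
  convolve-bounded i a b f g bf bg n a+b<n e = ≡.subst (λ n → at i n (convolve f g) e ≈ 0#)
    (ℕ.m+[n∸m]≡n {a} (ℕ.≤-trans (ℕ.m≤m+n a b) (ℕ.<⇒≤ a+b<n)))
    (trans (convolve-at i a (n ℕ.∸ a) f g bf (λ m n∸a<m → bg m (ℕ.<-trans b<n∸a n∸a<m)) e)
           (convolve-zeroʳ (at i a f) (at i (n ℕ.∸ a) g) (bg (n ℕ.∸ a) b<n∸a) e))
    where
    b<n∸a : b < n ℕ.∸ a
    b<n∸a = ℕ.m+n≤o⇒m≤o∸n (suc b) (≡.subst (_< n) (ℕ.+-comm a b) a+b<n)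

  leadingDegree : ∀ {k} i b (f : Coefficients (suc k)) → VanishesBeyond b f → Nonzero f →
                  ∃[ d ] Nonzero (at i d f) × BoundedIn i d f
  leadingDegree i b f v (e , fe≉0) =
    d , nz , λ n d<n → ¬Nonzero⇒≈0 (at i n f) λ nz′ → ℕ.<⇒≱ d<n (max n (n≤b n nz′) nz′)
    where
    n≤b : ∀ n → Nonzero (at i n f) → n < suc b
    n≤b n (e , fe≉0) = s≤s (ℕ.≮⇒≥ λ b<n → fe≉0 (v (insertAt e i n) (insertAt-Any e i b<n)))
    nz₀ : Nonzero (at i (lookup e i) f)
    nz₀ = removeAt e i , ≡.subst (λ e → f e ≉ 0#) (≡.sym (insertAt-removeAt e i)) fe≉0
    top = greatest (λ n → nonzero? b (at i n f) (at-vanishes i n {f} v)) (suc b)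
            (lookup e i , n≤b _ nz₀ , nz₀)
    d = proj₁ top
    nz = proj₁ (proj₂ top)
    max = proj₂ (proj₂ top)

  -- Induction on the number of variables: the leading coefficients in the first variable are
  -- nonzero polynomials in the others, and the top coefficient of the product is their product.
  Nonzero-convolve : ∀ {k} b d (f g : Coefficients k) → VanishesBeyond b f → VanishesBeyond d g →
                     Nonzero f → Nonzero g → Nonzero (convolve f g)
  Nonzero-convolve {zero} b d f g vf vg ([] , f≉0) ([] , g≉0) = [] , *-≉0 f≉0 g≉0
  Nonzero-convolve {suc k} b d f g vf vg nf ng
    with leadingDegree Fin.zero b f vf nf | leadingDegree Fin.zero d g vg ng
  ... | m , nfₘ , bf | n , ngₙ , bg
    with Nonzero-convolve b d (slice m f) (slice n g)
           (at-vanishes Fin.zero m {f} vf) (at-vanishes Fin.zero n {g} vg) nfₘ ngₙ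
  ... | e , fg≉0 = m ℕ.+ n ∷ e , λ fg≈0 → fg≉0 (trans (sym (convolve-top m n f g bf bg e)) fg≈0)

  Nonzeroₚ : ∀ {k} → Poly k → Set ℓ
  Nonzeroₚ f = Nonzero (coeff f)

  nonzeroₚ? : ∀ {k} (f : Poly k) → Dec (Nonzeroₚ f)
  nonzeroₚ? f = nonzero? (bound f) (coeff f) (vanishes f)

  Nonzero-* : ∀ {k} (f g : Poly k) → Nonzeroₚ f → Nonzeroₚ g → Nonzeroₚ (f *ₚ g)
  Nonzero-* f g = Nonzero-convolve (bound f) (bound g) (coeff f) (coeff g) (vanishes f) (vanishes g)

  Nonzero-*⁻ˡ : ∀ {k} (f g : Poly k) → Nonzeroₚ (f *ₚ g) → Nonzeroₚ f
  Nonzero-*⁻ˡ f g (e , fg≉0) = decidable-stable (nonzeroₚ? f) λ ¬nz →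
    fg≉0 (convolve-zeroˡ (coeff f) (coeff g) (¬Nonzero⇒≈0 (coeff f) ¬nz) e)

  Nonzero-*⁻ʳ : ∀ {k} (f g : Poly k) → Nonzeroₚ (f *ₚ g) → Nonzeroₚ g
  Nonzero-*⁻ʳ f g (e , fg≉0) = decidable-stable (nonzeroₚ? g) λ ¬nz →
    fg≉0 (convolve-zeroʳ (coeff f) (coeff g) (¬Nonzero⇒≈0 (coeff g) ¬nz) e)

  module R {k : ℕ} = CommutativeRing (polyRing k)

  ¬Nonzero⇒≃0 : ∀ {k} (f : Poly k) → ¬ Nonzeroₚ f → f ≃ 0ₚ
  ¬Nonzero⇒≃0 f ¬nz = ≃⁺ (¬Nonzero⇒≈0 (coeff f) ¬nz)

  *ₚ-cancelˡ : ∀ {k} (f g h : Poly k) → Nonzeroₚ f → f *ₚ g ≃ f *ₚ h → g ≃ h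
  *ₚ-cancelˡ {k} f g h nf fg≃fh = x∙y⁻¹≈ε⇒x≈y R.+-group g h
    (¬Nonzero⇒≃0 (g +ₚ -ₚ h) λ nz → let (e , f[g-h]≉0) = Nonzero-* f (g +ₚ -ₚ h) nf nz in
      f[g-h]≉0 (≃⁻ f[g-h]≃0 e))
    where
    f[g-h]≃0 : f *ₚ (g +ₚ -ₚ h) ≃ 0ₚ
    f[g-h]≃0 = R.trans (R.distribˡ f g (-ₚ h)) (R.trans
      (R.+-cong fg≃fh (R.sym (-‿distribʳ-* R.ring f h))) (R.-‿inverseʳ (f *ₚ h)))

  hasDegreeIn⁺ : ∀ {k} i (f : Poly (suc k)) {d} → Nonzero (at i d (coeff f)) →
                 BoundedIn i d (coeff f) →
                 HasDegreeIn i f d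
  hasDegreeIn⁺ i f {d} (e , fe≉0) bf =
    (insertAt e i d , insertAt-lookup e i d , fe≉0) ,
    λ e fe≉0 → ℕ.≮⇒≥ λ d<eᵢ → fe≉0
      (≡.subst (λ e → coeff f e ≈ 0#) (insertAt-removeAt e i) (bf (lookup e i) d<eᵢ (removeAt e i)))

  hasDegreeIn⁻ : ∀ {k} i (f : Poly (suc k)) {d} → HasDegreeIn i f d →
                 Nonzero (at i d (coeff f)) × BoundedIn i d (coeff f)
  hasDegreeIn⁻ i f {d} ((e , eᵢ≡d , fe≉0) , max) =
    (removeAt e i , λ fe≈0 → fe≉0
      (≡.subst (λ e → coeff f e ≈ 0#)
        (≡.trans (≡.cong (insertAt (removeAt e i) i) (≡.sym eᵢ≡d)) (insertAt-removeAt e i)) fe≈0)) ,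
    λ n d<n e → decidable-stable (_ ≟ 0#) λ fe≉0 → ℕ.<⇒≱ d<n
      (≡.subst (_≤ d) (insertAt-lookup e i n) (max (insertAt e i n) fe≉0))

  HasDegreeIn-* : ∀ {k} (i : Fin k) (f g : Poly k) {a b} → HasDegreeIn i f a → HasDegreeIn i g b →
                  HasDegreeIn i (f *ₚ g) (a ℕ.+ b)
  HasDegreeIn-* {suc k} i f g {a} {b} df dg with hasDegreeIn⁻ i f df | hasDegreeIn⁻ i g dg
  ... | nf , bf | ng , bg = hasDegreeIn⁺ i (f *ₚ g)
    (Nonzero-cong (λ e → sym (convolve-at i a b (coeff f) (coeff g) bf bg e))
      (Nonzero-convolve (bound f) (bound g) (at i a (coeff f)) (at i b (coeff g))
        (at-vanishes i a {coeff f} (vanishes f)) (at-vanishes i b {coeff g} (vanishes g)) nf ng))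
    (convolve-bounded i a b (coeff f) (coeff g) bf bg)

  Deg-* : ∀ {k} {f g : Poly k} {a b} → Deg a f → Deg b g → Deg (a ⊕ b) (f *ₚ g)
  Deg-* {f = f} {g} {a} {b} (deg⁺ df) (deg⁺ dg) = deg⁺ λ i →
    ≡.subst (HasDegreeIn i (f *ₚ g)) (≡.sym (lookup-zipWith ℕ._+_ i a b))
      (HasDegreeIn-* i f g (df i) (dg i))

  HasDegreeIn-unique : ∀ {k} (i : Fin k) (f : Poly k) {a b} → HasDegreeIn i f a →
                       HasDegreeIn i f b → a ≡ b
  HasDegreeIn-unique i f ((e , eᵢ≡a , fe≉0) , max) ((e′ , e′ᵢ≡b , fe′≉0) , max′) = ℕ.≤-antisym
    (≡.subst (_≤ _) eᵢ≡a (max′ e fe≉0)) (≡.subst (_≤ _) e′ᵢ≡b (max e′ fe′≉0))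

  Deg-unique : ∀ {k} {f : Poly k} {a b} → Deg a f → Deg b f → a ≡ b
  Deg-unique {f = f} (deg⁺ da) (deg⁺ db) = lookup-injective λ i → HasDegreeIn-unique i f (da i)
    (db i)

  Deg-exists : ∀ {k} (f : Poly k) → Nonzeroₚ f → ∃[ m ] Deg m f
  Deg-exists {zero}  f nf = [] , deg⁺ λ ()
  Deg-exists {suc k} f nf = tabulate d , deg⁺ λ i →
    ≡.subst (HasDegreeIn i f) (≡.sym (lookup∘tabulate d i))
      (hasDegreeIn⁺ i f (proj₁ (proj₂ (degree i))) (proj₂ (proj₂ (degree i))))
    where
    degree = λ i → leadingDegree i (bound f) (coeff f) (vanishes f) nf
    d = λ i → proj₁ (degree i)

  Deg⇒Nonzero : ∀ {k} {f : Poly (suc k)} {m} → Deg m f → Nonzeroₚ f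
  Deg⇒Nonzero (deg⁺ df) with df Fin.zero
  ... | (e , _ , fe≉0) , _ = e , fe≉0

  Deg-bounds : ∀ {k} {f : Poly k} {m} → Deg m f → ∀ i e → lookup m i < lookup e i → coeff f e ≈ 0#
  Deg-bounds (deg⁺ df) i e m<e = decidable-stable (_ ≟ 0#) λ fe≉0 → ℕ.<⇒≱ m<e (proj₂ (df i) e fe≉0)

  infix 4 _≅_
  record _≅_ {k} (f g : Poly k) : Set (c ⊔ ℓ) where
    constructor ≅⁺
    field ≅⁻ : f ∼ g

  open _≅_ public

  module N {k : ℕ} = Setoid (normalizedSetoid k)

  ≅-sym : ∀ {k} {f g : Poly k} → f ≅ g → g ≅ f
  ≅-sym {f = f} {g} (≅⁺ f∼g) = ≅⁺ (N.sym {x = f} {g} f∼g)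

  ≅-trans : ∀ {k} {f g h : Poly k} → f ≅ g → g ≅ h → f ≅ h
  ≅-trans {f = f} {g} {h} (≅⁺ f∼g) (≅⁺ g∼h) = ≅⁺ (N.trans {i = f} {g} {h} f∼g g∼h)

  ≃⇒≅ : ∀ {k} {f g : Poly k} → f ≃ g → f ≅ g
  ≃⇒≅ (≃⁺ f≈g) = ≅⁺ (1# , 1≉0 , λ e → trans (f≈g e) (sym (*-identityˡ _)))

  Deg-resp-≅ : ∀ {k} {f g : Poly k} {m} → f ≅ g → Deg m f → Deg m g
  Deg-resp-≅ (≅⁺ (u , u≉0 , f≈ug)) (deg⁺ df) = deg⁺ λ i → let ((e , eᵢ≡d , fe≉0) , max) = df i in
    (e , eᵢ≡d , λ ge≈0 → fe≉0 (trans (f≈ug e) (trans (*-congˡ ge≈0) (zeroʳ u)))) ,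
    λ e ge≉0 → max e λ fe≈0 → *-≉0 u≉0 ge≉0 (trans (sym (f≈ug e)) fe≈0)

  Deg-resp-≃ : ∀ {k} {f g : Poly k} {m} → f ≃ g → Deg m f → Deg m g
  Deg-resp-≃ f≃g = Deg-resp-≅ (≃⇒≅ f≃g)

  scale : ∀ {k} → Carrier → Poly k → Poly k
  scale u f =
    mkPoly (λ e → u * coeff f e) (bound f) λ e b<e → trans (*-congˡ (vanishes f e b<e)) (zeroʳ u)

  convolve-scaleˡ : ∀ {k} u (f g : Coefficients k) →
                    convolve (λ e → u * f e) g ≋ λ e → u * convolve f g e
  convolve-scaleˡ u f g []      = *-assoc u _ _
  convolve-scaleˡ u f g (n ∷ e) = trans
    (sum-cong-≋ {suc n} λ i → convolve-scaleˡ u (slice (toℕ i) f) (slice (n ℕ.∸ toℕ i) g) e)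
    (sym (*-distribˡ-sum {suc n} u λ i → convolve (slice (toℕ i) f) (slice (n ℕ.∸ toℕ i) g) e))

  scale-*ˡ : ∀ {k} u (f g : Poly k) → scale u f *ₚ g ≃ scale u (f *ₚ g)
  scale-*ˡ u f g = ≃⁺ (convolve-scaleˡ u (coeff f) (coeff g))

  scale-cong : ∀ {k} u {f g : Poly k} → f ≃ g → scale u f ≃ scale u g
  scale-cong u (≃⁺ f≈g) = ≃⁺ λ e → *-congˡ (f≈g e)

  scale-*ʳ : ∀ {k} u (f g : Poly k) → f *ₚ scale u g ≃ scale u (f *ₚ g)
  scale-*ʳ u f g =
    R.trans (R.*-comm f (scale u g)) (R.trans (scale-*ˡ u g f) (scale-cong u (R.*-comm g f)))

  scale-≅ : ∀ {k u} (f : Poly k) → u ≉ 0# → scale u f ≅ f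
  scale-≅ {u = u} f u≉0 = ≅⁺ (u , u≉0 , λ _ → refl)

  -- Divisibility and units

  module _ {k : ℕ} where
    open import Algebra.Definitions.RawSemiring (polyRawSemiring k) public
      using () renaming (_∣_ to _∣ₚ_)

  Unit : ∀ {k} → Poly k → Set (c ⊔ ℓ)
  Unit f = f ∣ₚ 1ₚ

  δ-zero : ∀ k → δ (replicate k 0) ≈ 1#
  δ-zero zero    = refl
  δ-zero (suc k) = δ-zero k

  δ-≉0 : ∀ {k} e → δ {k} e ≉ 0# → e ≡ replicate k 0
  δ-≉0 []           _   = ≡.refl
  δ-≉0 (zero ∷ e)   δ≉0 = ≡.cong (0 ∷_) (δ-≉0 e δ≉0)
  δ-≉0 (suc _ ∷ _)  δ≉0 = ⊥-elim (δ≉0 refl)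

  1ₚ-Nonzero : ∀ {k} → Nonzeroₚ (1ₚ {k})
  1ₚ-Nonzero {k} = replicate k 0 , λ δ≈0 → 1≉0 (trans (sym (δ-zero k)) δ≈0)

  Deg-1ₚ : ∀ {k} → Deg (replicate k 0) 1ₚ
  Deg-1ₚ {k} = deg⁺ λ i → (replicate k 0 , ≡.refl , proj₂ (1ₚ-Nonzero {k})) ,
    λ e δ≉0 → ℕ.≤-reflexive (≡.cong (λ e → lookup e i) (δ-≉0 e δ≉0))

  ⊕-≡0ʳ : ∀ {n} (a b : Vec ℕ n) → a ⊕ b ≡ replicate n 0 → b ≡ replicate n 0
  ⊕-≡0ʳ []      []      _  = ≡.refl
  ⊕-≡0ʳ (x ∷ a) (y ∷ b) eq =
    ≡.cong₂ _∷_ (ℕ.m+n≡0⇒n≡0 x (≡.cong Vec.head eq)) (⊕-≡0ʳ a b (≡.cong Vec.tail eq))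

  Unit⇒Deg-0 : ∀ {k} {f : Poly k} → Unit f → Deg (replicate k 0) f
  Unit⇒Deg-0 {k} {f} (RawMagma._,_ g gf≈1)
    with Deg-exists g (Nonzero-*⁻ˡ g f nz) | Deg-exists f (Nonzero-*⁻ʳ g f nz)
    where nz = Nonzero-cong (λ e → sym (gf≈1 e)) 1ₚ-Nonzero
  ... | a , dg | b , df = ≡.subst (λ m → Deg m f)
    (⊕-≡0ʳ a b (Deg-unique (Deg-* dg df) (Deg-resp-≃ (R.sym (≃⁺ gf≈1)) Deg-1ₚ))) df

  Deg-0⇒constant : ∀ {k} {f : Poly k} → Deg (replicate k 0) f →
                   f ≃ scale (coeff f (replicate k 0)) 1ₚ
  Deg-0⇒constant {k} {f} df = ≃⁺ go
    where
    positive : ∀ {k} (e : Vec ℕ k) → δ e ≈ 0# → ∃[ i ] 0 < lookup e i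
    positive []          1≈0 = ⊥-elim (1≉0 1≈0)
    positive (zero ∷ e)  δ≈0 with positive e δ≈0
    ... | i , 0<eᵢ = Fin.suc i , 0<eᵢ
    positive (suc _ ∷ e) _   = Fin.zero , s≤s z≤n
    fe≈0 : ∀ e → δ e ≈ 0# → coeff f e ≈ 0#
    fe≈0 e δ≈0 with positive e δ≈0
    ... | i , 0<eᵢ = Deg-bounds df i e (≡.subst (_< lookup e i) (≡.sym (lookup-replicate i 0)) 0<eᵢ)
    go : ∀ e → coeff f e ≈ coeff f (replicate k 0) * δ e
    go e with δ e ≟ 0#
    ... | no δ≉0 with ≡.refl ← δ-≉0 e δ≉0 = sym (trans (*-congˡ (δ-zero k)) (*-identityʳ _))
    ... | yes δ≈0 = trans (fe≈0 e δ≈0) (sym (trans (*-congˡ δ≈0) (zeroʳ _)))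

  -- At least one variable is required: in no variables `Deg` is vacuous and holds for 0 as well.
  Deg-0⇒Unit : ∀ {k} {f : Poly (suc k)} → Deg (replicate (suc k) 0) f → Unit f
  Deg-0⇒Unit {k} {f} df with inverse u u≉0
    where
    u = coeff f (replicate (suc k) 0)
    u≉0 : u ≉ 0#
    u≉0 u≈0 with Deg⇒Nonzero df
    ... | e , fe≉0 = fe≉0 (trans (≃⁻ (Deg-0⇒constant df) e) (trans (*-congʳ u≈0) (zeroˡ _)))
  ... | w , uw≈1 = RawMagma._,_ (scale w 1ₚ) (≃⁻ {g = 1ₚ} (R.trans (scale-*ˡ w 1ₚ f)
    (R.trans (scale-cong w (R.trans (R.*-identityˡ f) (Deg-0⇒constant df)))
      (≃⁺ λ e → trans (sym (*-assoc w _ _))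
        (trans (*-congʳ (trans (*-comm w _) uw≈1)) (*-identityˡ _))))))

  -- Counting classes

  tableSize : ∀ {k} → Vec ℕ k → ℕ
  tableSize []      = q
  tableSize (n ∷ m) = tableSize m ^ suc n

  tableSize≡ : ∀ {k} (m : Vec ℕ k) → tableSize m ≡ q ^ boxSize m
  tableSize≡ []      = ≡.sym (ℕ.*-identityʳ q)
  tableSize≡ (n ∷ m) = ≡.trans (≡.cong (_^ suc n) (tableSize≡ m))
    (≡.trans (ℕ.^-*-assoc q (boxSize m) (suc n)) (≡.cong (q ^_) (ℕ.*-comm (boxSize m) (suc n))))

  table : ∀ {k} (m : Vec ℕ k) → Fin (tableSize m) → Coefficients k
  table []      i []      = Inverse.from enumeration i
  table (n ∷ m) i (j ∷ e) with j ℕ.<? suc n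
  ... | yes j≤n = table m (finToFun i (fromℕ< j≤n)) e
  ... | no  _   = 0#

  table-vanishes : ∀ {k} b (m : Vec ℕ k) i → maximum m ≤ b → VanishesBeyond b (table m i)
  table-vanishes b (n ∷ m) i m≤b (j ∷ e) b<je with j ℕ.<? suc n
  ... | no _ = refl
  table-vanishes b (n ∷ m) i m≤b (j ∷ e) (here b<j) | yes j≤n =
    ⊥-elim (ℕ.<⇒≱ b<j (ℕ.≤-trans (ℕ.s≤s⁻¹ j≤n) (ℕ.≤-trans (ℕ.m≤m⊔n n _) m≤b)))
  table-vanishes b (n ∷ m) i m≤b (j ∷ e) (there b<e) | yes j≤n =
    table-vanishes b m (finToFun i (fromℕ< j≤n)) (ℕ.≤-trans (ℕ.m≤n⊔m n _) m≤b) e b<e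

  BoundedBy : ∀ {k} → Vec ℕ k → Coefficients k → Set ℓ
  BoundedBy m f = ∀ i e → lookup m i < lookup e i → f e ≈ 0#

  table-complete : ∀ {k} (m : Vec ℕ k) f → BoundedBy m f → ∃[ i ] f ≋ table m i
  table-complete []      f bf =
    Inverse.to enumeration (f []) , λ { [] → sym (Inverse.strictlyInverseʳ enumeration (f [])) }
  table-complete (n ∷ m) f bf = funToFin rows , eq
    where
    rec = λ j → table-complete m (slice j f) λ i e → bf (Fin.suc i) (j ∷ e)
    rows : Fin (suc n) → Fin (tableSize m)
    rows j = proj₁ (rec (toℕ j))
    eq : f ≋ table (n ∷ m) (funToFin rows)
    eq (j ∷ e) with j ℕ.<? suc n
    ... | no  j≰n = bf Fin.zero (j ∷ e) (ℕ.≮⇒≥ j≰n)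
    ... | yes j≤n rewrite Fin.finToFun-funToFin rows (fromℕ< j≤n) | Fin.toℕ-fromℕ< j≤n =
      proj₂ (rec j) e

  -- Degrees are at most `m`, not exactly `m`. This makes the length a pure power of q and also
  -- suits the search for factors of smaller degree.
  polys : ∀ {k} → Vec ℕ k → List (Poly k)
  polys m =
    List.tabulate λ i → mkPoly (table m i) (maximum m) (table-vanishes (maximum m) m i ℕ.≤-refl)

  length-polys : ∀ {k} (m : Vec ℕ k) → length (polys m) ≡ q ^ boxSize m
  length-polys m = ≡.trans (List.length-tabulate _) (tableSize≡ m)

  polys-complete : ∀ {k} (m : Vec ℕ k) (f : Poly k) → BoundedBy m (coeff f) →
                   ListAny.Any (f ≃_) (polys m)
  polys-complete m f bf with table-complete m (coeff f) bf
  ... | i , f≋ = ListAny.tabulate⁺ i (≃⁺ f≋)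

  Deg⇒BoundedBy : ∀ {k} {a m : Vec ℕ k} {f} → Deg a f → (∀ i → lookup a i ≤ lookup m i) →
                  BoundedBy m (coeff f)
  Deg⇒BoundedBy df a≤m i e mᵢ<eᵢ = Deg-bounds df i e (ℕ.≤-<-trans (a≤m i) mᵢ<eᵢ)

  -- Decidability of association, degree and irreducibility

  _≃?_ : ∀ {k} (f g : Poly k) → Dec (f ≃ g)
  f ≃? g = map′
    (λ ¬nz → x∙y⁻¹≈ε⇒x≈y R.+-group f g (¬Nonzero⇒≃0 (f +ₚ -ₚ g) ¬nz))
    (λ f≃g (e , fe-ge≉0) → fe-ge≉0 (≃⁻ (x≈y⇒x∙y⁻¹≈ε R.+-group {f} {g} f≃g) e))
    (¬? (nonzeroₚ? (f +ₚ -ₚ g)))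

  _≅?_ : ∀ {k} (f g : Poly k) → Dec (f ≅ g)
  f ≅? g = map′
    (λ (i , u≉0 , f≃ug) → ≅⁺ (from i , u≉0 , ≃⁻ f≃ug))
    (λ (≅⁺ (u , u≉0 , f≈ug)) → to u ,
      (λ fu≈0 → u≉0 (trans (sym (strictlyInverseʳ u)) fu≈0)) ,
      ≃⁺ λ e → trans (f≈ug e) (*-congʳ (sym (strictlyInverseʳ u))))
    (Fin.any? λ i → ¬? (from i ≟ 0#) ×-dec (f ≃? scale (from i) g))
    where open Inverse enumeration

  deg? : ∀ {k} m (f : Poly (suc k)) → Dec (Deg m f)
  deg? m f with nonzeroₚ? f
  ... | no ¬nz = no λ df → ¬nz (Deg⇒Nonzero df)
  ... | yes nz with Deg-exists f nz
  ... | a , da = map′ (λ { ≡.refl → da }) (Deg-unique da) (Vec.≡-dec ℕ._≟_ a m)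

  unit? : ∀ {k} (f : Poly (suc k)) → Dec (Unit f)
  unit? {k} f = map′ Deg-0⇒Unit Unit⇒Deg-0 (deg? (replicate (suc k) 0) f)

  Unit-resp-≃ : ∀ {k} {f g : Poly k} → f ≃ g → Unit f → Unit g
  Unit-resp-≃ {f = f} {g} f≃g (RawMagma._,_ h hf≈1) =
    RawMagma._,_ h (≃⁻ {g = 1ₚ} (R.trans (R.*-cong (R.refl {x = h}) (R.sym f≃g)) (≃⁺ hf≈1)))

  record Splits {k} (f : Poly k) : Set (c ⊔ ℓ) where
    constructor splits⁺
    field
      {x y} : Poly k
      f≃xy  : f ≃ x *ₚ y
      ¬ux   : ¬ Unit x
      ¬uy   : ¬ Unit y

  ¬Unit-Deg : ∀ {k} {f : Poly k} {m} i → Deg m f → 0 < lookup m i → ¬ Unit f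
  ¬Unit-Deg {k} {f} {m} i df 0<mᵢ uf = ℕ.<⇒≢ 0<mᵢ
    (≡.trans (≡.sym (Vec.lookup-replicate i 0))
      (≡.cong (λ m → lookup m i) (Deg-unique (Unit⇒Deg-0 uf) df)))

  Deg-factors : ∀ {k} {f x y : Poly (suc k)} {m} → Deg m f → f ≃ x *ₚ y →
                ∃[ a ] ∃[ b ] Deg a x × Deg b y × a ⊕ b ≡ m
  Deg-factors {f = f} {x} {y} df f≃xy = let
    nz = Nonzero-cong {f = coeff f} {coeff (x *ₚ y)} (≃⁻ f≃xy) (Deg⇒Nonzero df)
    (a , da) = Deg-exists x (Nonzero-*⁻ˡ x y nz)
    (b , db) = Deg-exists y (Nonzero-*⁻ʳ x y nz)
    in a , b , da , db , Deg-unique (Deg-* da db) (Deg-resp-≃ f≃xy df)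

  IsSplitting : ∀ {k} → Poly k → Poly k → Poly k → Set (c ⊔ ℓ)
  IsSplitting f x y = f ≃ x *ₚ y × ¬ Unit x × ¬ Unit y

  splitting? : ∀ {k} (f x y : Poly (suc k)) → Dec (IsSplitting f x y)
  splitting? f x y = (f ≃? (x *ₚ y)) ×-dec (¬? (unit? x) ×-dec ¬? (unit? y))

  IsSplitting-resp : ∀ {k} {f x x′ y y′ : Poly k} → x ≃ x′ → y ≃ y′ → IsSplitting f x y →
                     IsSplitting f x′ y′
  IsSplitting-resp x≃x′ y≃y′ (f≃xy , ¬ux , ¬uy) =
    R.trans f≃xy (R.*-cong x≃x′ y≃y′) ,
    (λ ux′ → ¬ux (Unit-resp-≃ (R.sym x≃x′) ux′)) ,
    (λ uy′ → ¬uy (Unit-resp-≃ (R.sym y≃y′) uy′))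

  Listed : ∀ {k} → Vec ℕ k → Poly k → Set (c ⊔ ℓ)
  Listed m f = ListAny.Any (λ x → ListAny.Any (IsSplitting f x) (polys m)) (polys m)

  listed : ∀ {k} {m} {f x y : Poly (suc k)} → Deg m f → IsSplitting f x y → Listed m f
  listed {m = m} {f} {x} {y} df spl = let (a , b , da , db , a⊕b≡m) = Deg-factors df (proj₁ spl) in
    ListAny.map
      (λ x≃x′ → ListAny.map (λ y≃y′ → IsSplitting-resp x≃x′ y≃y′ spl)
        (polys-complete m y
          (Deg⇒BoundedBy {m = m} db λ i → ℕ.≤-trans (ℕ.m≤n+m _ _) (sum≤ a b a⊕b≡m i))))
      (polys-complete m x
        (Deg⇒BoundedBy {m = m} da λ i → ℕ.≤-trans (ℕ.m≤m+n _ _) (sum≤ a b a⊕b≡m i)))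
    where
    sum≤ : ∀ a b → a ⊕ b ≡ m → ∀ i → lookup a i ℕ.+ lookup b i ≤ lookup m i
    sum≤ a b a⊕b≡m i =
      ℕ.≤-reflexive (≡.trans (≡.sym (lookup-⊕ a b i)) (≡.cong (λ m → lookup m i) a⊕b≡m))

  listed? : ∀ {k} m (f : Poly (suc k)) → Dec (Listed m f)
  listed? m f = ListAny.any? (λ x → ListAny.any? (splitting? f x) (polys m)) (polys m)

  -- A finite search decides the alternative: degrees add under multiplication, so both factors of
  -- `f` have degrees at most `m` and occur, up to `_≃_`, in `polys m`.
  irreducible⊎splits : ∀ {k} (f : Poly (suc k)) {m} → Deg m f → ¬ Unit f → Irreducible f ⊎ Splits f
  irreducible⊎splits {k} f {m} df ¬uf = decide (listed? m f)
    where
    split : ¬ Listed m f → ∀ x y → f ≃ x *ₚ y → Dec (Unit x) → Dec (Unit y) → Unit x ⊎ Unit y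
    split ¬l x y f≃xy (yes ux) _        = inj₁ ux
    split ¬l x y f≃xy (no _)   (yes uy) = inj₂ uy
    split ¬l x y f≃xy (no ¬ux) (no ¬uy) = ⊥-elim (¬l (listed df (f≃xy , ¬ux , ¬uy)))
    decide : Dec (Listed m f) → Irreducible f ⊎ Splits f
    decide (yes l) = let (x , _ , l′) = find l
                         (y , _ , f≃xy , ¬ux , ¬uy) = find l′ in inj₂ (splits⁺ f≃xy ¬ux ¬uy)
    decide (no ¬l) = inj₁ (RawSemiring.mkIrred ¬uf
      λ {x} {y} f≈xy → split ¬l x y (≃⁺ f≈xy) (unit? x) (unit? y))

  ¬Irreducible∧Splits : ∀ {k} {f : Poly k} → Irreducible f → ¬ Splits f
  ¬Irreducible∧Splits (RawSemiring.mkIrred _ split) (splits⁺ {x} {y} f≃xy ¬ux ¬uy)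
    with split {x} {y} (≃⁻ f≃xy)
  ... | inj₁ ux = ¬ux ux
  ... | inj₂ uy = ¬uy uy

  irreducible? : ∀ {k} (f : Poly (suc k)) {m} i → Deg m f → 0 < lookup m i → Dec (Irreducible f)
  irreducible? f i df 0<mᵢ =
    [ yes , (λ spl → no λ irr → ¬Irreducible∧Splits irr spl) ]′
      (irreducible⊎splits f df (¬Unit-Deg i df 0<mᵢ))

  Irreducible-resp-≃ : ∀ {k} {f g : Poly k} → f ≃ g → Irreducible f → Irreducible g
  Irreducible-resp-≃ {f = f} {g} f≃g (RawSemiring.mkIrred ¬uf split) = RawSemiring.mkIrred
    (λ ug → ¬uf (Unit-resp-≃ (R.sym f≃g) ug))
    λ {x} {y} g≈xy → split {x} {y} (≃⁻ (R.trans f≃g (≃⁺ {g = x *ₚ y} g≈xy)))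

  count : ∀ {k p} (m : Vec ℕ k) (P : Pred (Poly k) p) → (∀ f → Dec (P f)) →
          (∀ {f g} → f ≃ g → P f → P g) → (∀ {f} → P f → BoundedBy m (coeff f)) →
          ∃[ n ] NumberOfNormalized P n
  count {k} m P P? resp bounded = enumeration⇒count
    (record { isDecEquivalence = record
      { isEquivalence = Setoid.isEquivalence (On.setoid (normalizedSetoid k) (proj₁ {B = P}))
      ; _≟_ = λ (f , _) (g , _) → map′ ≅⁻ ≅⁺ (f ≅? g) } })
    {concatMap select (polys m)}
    λ (f , Pf) → ListAny.concatMap⁺ select
      (ListAny.map (select⁺ f Pf) (polys-complete m f (bounded Pf)))
    where
    select : Poly k → List (∃[ f ] P f)
    select f with P? f
    ... | yes Pf = (f , Pf) ∷ []
    ... | no _   = []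
    select⁺ : ∀ f (Pf : P f) {g} → f ≃ g → ListAny.Any (λ h → f ∼ proj₁ h) (select g)
    select⁺ f Pf {g} f≃g with P? g
    ... | yes Pg = here (≅⁻ (≃⇒≅ f≃g))
    ... | no ¬Pg = ⊥-elim (¬Pg (resp f≃g Pf))

  count-N : ∀ {k} (m : Vec ℕ (suc k)) → ∃[ n ] IsN F m n
  count-N m = count m (HasDeg m) (λ f → map′ deg⁻ deg⁺ (deg? m f))
    (λ f≃g df → deg⁻ (Deg-resp-≃ {m = m} f≃g (deg⁺ {m = m} df)))
    (λ {f} df → Deg⇒BoundedBy {m = m} {f} (deg⁺ {m = m} df) λ _ → ℕ.≤-refl)

  count-I : ∀ {k} (m : Vec ℕ (suc k)) i → 0 < lookup m i → ∃[ n ] IsI F m n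
  count-I m i 0<mᵢ = count m _ dec
    (λ f≃g (df , irr) →
      deg⁻ (Deg-resp-≃ {m = m} f≃g (deg⁺ {m = m} df)) , Irreducible-resp-≃ f≃g irr)
    (λ {f} (df , _) → Deg⇒BoundedBy {m = m} {f} (deg⁺ {m = m} df) λ _ → ℕ.≤-refl)
    where
    dec′ : ∀ f → Dec (Deg m f) → Dec (HasDeg m f × Irreducible f)
    dec′ f (no ¬df) = no λ (df , _) → ¬df (deg⁺ df)
    dec′ f (yes df) = map′ (deg⁻ df ,_) proj₂ (irreducible? f i df 0<mᵢ)
    dec : ∀ f → Dec (HasDeg m f × Irreducible f)
    dec f = dec′ f (deg? m f)

  -- Contents

  -- A polynomial in p + 1 variables is viewed as the family of its rows:
  -- univariate polynomials in the last variable, indexed by the exponents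
  -- of the other variables.

  row : ∀ {p} → Vec ℕ p → Coefficients (suc p) → Coefficients 1
  row []      f = f
  row (n ∷ e) f = row e (slice n f)

  row-cong : ∀ {p} (e : Vec ℕ p) {f g : Coefficients (suc p)} → f ≋ g → row e f ≋ row e g
  row-cong []      f≋g = f≋g
  row-cong (n ∷ e) f≋g = row-cong e λ v → f≋g (n ∷ v)

  row-ext : ∀ {p} {f g : Coefficients (suc p)} → (∀ e → row e f ≋ row e g) → f ≋ g
  row-ext {zero}  rows v       = rows [] v
  row-ext {suc p} rows (n ∷ v) = row-ext (λ e → rows (n ∷ e)) v

  row-⊞ : ∀ {p} (e : Vec ℕ p) (f g : Coefficients (suc p)) → row e (f ⊞ g) ≋ row e f ⊞ row e g
  row-⊞ []      f g _ = refl
  row-⊞ (n ∷ e) f g   = row-⊞ e (slice n f) (slice n g)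

  row-neg : ∀ {p} (e : Vec ℕ p) (f : Coefficients (suc p)) → row e (λ v → - f v) ≋ λ v → - row e f v
  row-neg []      f _ = refl
  row-neg (n ∷ e) f   = row-neg e (slice n f)

  row-vanishes : ∀ {p b} (e : Vec ℕ p) {f : Coefficients (suc p)} → VanishesBeyond b f →
                 VanishesBeyond b (row e f)
  row-vanishes []      v = v
  row-vanishes (n ∷ e) v = row-vanishes e λ w b<w → v (n ∷ w) (there b<w)

  row-Nonzero : ∀ {p} {f : Coefficients (suc p)} → Nonzero f → ∃[ e ] Nonzero (row e f)
  row-Nonzero {zero}  nz                  = [] , nz
  row-Nonzero {suc p} {f} (n ∷ v , fv≉0) = let (e , nz) = row-Nonzero {f = slice n f} (v , fv≉0) in n ∷ e , nz

  rowₚ : ∀ {p} → Vec ℕ p → Poly (suc p) → Poly 1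
  rowₚ e f = mkPoly (row e (coeff f)) (bound f) (row-vanishes e (vanishes f))

  embed : ∀ p → Coefficients 1 → Coefficients (suc p)
  embed zero    u             = u
  embed (suc p) u (zero  ∷ e) = embed p u e
  embed (suc p) u (suc _ ∷ e) = 0#

  embed-vanishes : ∀ p {b u} → VanishesBeyond b u → VanishesBeyond b (embed p u)
  embed-vanishes zero    v = v
  embed-vanishes (suc p) v (zero  ∷ e) (there b<e) = embed-vanishes p v e b<e
  embed-vanishes (suc p) v (suc _ ∷ e) _           = refl

  embedₚ : ∀ {p} → Poly 1 → Poly (suc p)
  embedₚ {p} u = mkPoly (embed p (coeff u)) (bound u) (embed-vanishes p (vanishes u))

  embed-cong : ∀ p {u v} → u ≋ v → embed p u ≋ embed p v
  embed-cong zero    u≋v = u≋v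
  embed-cong (suc p) u≋v (zero  ∷ e) = embed-cong p u≋v e
  embed-cong (suc p) u≋v (suc _ ∷ e) = refl

  convolve-embed : ∀ p u (f : Coefficients (2 ℕ.+ p)) n →
                   slice n (convolve (embed (suc p) u) f) ≋ convolve (embed p u) (slice n f)
  convolve-embed p u f zero    e = +-identityʳ _
  convolve-embed p u f (suc n) e = trans
    (+-congˡ (convolve-zeroˡ (shift (embed (suc p) u)) f (λ { (_ ∷ _) → refl }) (n ∷ e)))
    (+-identityʳ _)

  -- `embed p u` is supported on the single row with exponents 0, so multiplying by it acts on each
  -- row separately. Divisibility of `f` by a polynomial in the last variable thereby becomes a
  -- statement about univariate polynomials.
  row-embed : ∀ {p} (e : Vec ℕ p) u f → row e (convolve (embed p u) f) ≋ convolve u (row e f)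
  row-embed []      u f v = refl
  row-embed (n ∷ e) u f v =
    trans (row-cong e (convolve-embed _ u f n) v) (row-embed e u (slice n f) v)

  infixr 7 _•_
  _•_ : ∀ {p} → Poly 1 → Poly (suc p) → Poly (suc p)
  u • f = embedₚ u *ₚ f

  row-• : ∀ {p} (e : Vec ℕ p) u f → rowₚ e (u • f) ≃ u *ₚ rowₚ e f
  row-• e u f = ≃⁺ (row-embed e (coeff u) (coeff f))

  rowₚ-cong : ∀ {p} (e : Vec ℕ p) {f g} → f ≃ g → rowₚ e f ≃ rowₚ e g
  rowₚ-cong e (≃⁺ f≈g) = ≃⁺ (row-cong e f≈g)

  rowₚ-ext : ∀ {p} {f g : Poly (suc p)} → (∀ e → rowₚ e f ≃ rowₚ e g) → f ≃ g
  rowₚ-ext rows = ≃⁺ (row-ext λ e → ≃⁻ (rows e))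

  embedₚ-cong : ∀ {p u v} → u ≃ v → embedₚ {p} u ≃ embedₚ v
  embedₚ-cong {p} (≃⁺ u≈v) = ≃⁺ (embed-cong p u≈v)

  •-cong : ∀ {p u v} {f g : Poly (suc p)} → u ≃ v → f ≃ g → u • f ≃ v • g
  •-cong u≃v f≃g = R.*-cong (embedₚ-cong u≃v) f≃g

  •-assoc : ∀ {p} u v (f : Poly (suc p)) → (u *ₚ v) • f ≃ u • v • f
  •-assoc u v f = rowₚ-ext λ e → R.trans (row-• e (u *ₚ v) f) (R.trans (R.*-assoc u v (rowₚ e f))
    (R.sym (R.trans (row-• e u (v • f)) (R.*-cong (R.refl {x = u}) (row-• e v f)))))

  1-• : ∀ {p} (f : Poly (suc p)) → 1ₚ • f ≃ f
  1-• f = rowₚ-ext λ e → R.trans (row-• e 1ₚ f) (R.*-identityˡ (rowₚ e f))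

  scale-•ʳ : ∀ {p} a u (f : Poly (suc p)) → u • scale a f ≃ scale a (u • f)
  scale-•ʳ a u f = scale-*ʳ a (embedₚ u) f

  -- Monic polynomials in one variable

  record IsMonic (d : ℕ) (u : Poly 1) : Set ℓ where
    constructor monic⁺
    field
      leading : coeff u (d ∷ []) ≈ 1#
      above   : ∀ n → d < n → coeff u (n ∷ []) ≈ 0#

  open IsMonic

  monic-bounded : ∀ {d u} → IsMonic d u → BoundedIn Fin.zero d (coeff u)
  monic-bounded mu n d<n [] = above mu n d<n

  monic-Nonzero : ∀ {d u} → IsMonic d u → Nonzeroₚ u
  monic-Nonzero {d} mu = d ∷ [] , λ u≈0 → 1≉0 (trans (sym (leading mu)) u≈0)

  monic-resp-≃ : ∀ {d u v} → u ≃ v → IsMonic d u → IsMonic d v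
  monic-resp-≃ (≃⁺ u≈v) (monic⁺ l a) =
    monic⁺ (trans (sym (u≈v _)) l) λ n d<n → trans (sym (u≈v _)) (a n d<n)

  coeff-* : ∀ {d s u w} → IsMonic d u → BoundedIn Fin.zero s (coeff w) →
            coeff (u *ₚ w) (d ℕ.+ s ∷ []) ≈ coeff w (s ∷ [])
  coeff-* {d} {s} {u} {w} mu bw = trans
    (convolve-top d s (coeff u) (coeff w) (monic-bounded mu) bw [])
    (trans (*-congʳ (leading mu)) (*-identityˡ _))

  bounded-* : ∀ {d s u w} → IsMonic d u → BoundedIn Fin.zero s (coeff w) →
              BoundedIn Fin.zero (d ℕ.+ s) (coeff (u *ₚ w))
  bounded-* {d} {s} {u} {w} mu bw =
    convolve-bounded Fin.zero d s (coeff u) (coeff w) (monic-bounded mu) bw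

  monic-* : ∀ {d s u w} → IsMonic d u → IsMonic s w → IsMonic (d ℕ.+ s) (u *ₚ w)
  monic-* {u = u} {w} mu mw = monic⁺
    (trans (coeff-* {u = u} {w} mu (monic-bounded mw)) (leading mw))
    λ n d+s<n → bounded-* {u = u} {w} mu (monic-bounded mw) n d+s<n []

  monic-0 : ∀ {u} → IsMonic 0 u → u ≃ 1ₚ
  monic-0 mu = ≃⁺ λ { (zero ∷ []) → leading mu ; (suc n ∷ []) → above mu (suc n) (s≤s z≤n) }

  normalise : ∀ (u : Poly 1) → Nonzeroₚ u →
              ∃[ d ] ∃[ a ] a ≉ 0# × IsMonic d (scale a u) × coeff u (d ∷ []) ≉ 0#
  normalise u nz = let (d , nz′ , bu) = leadingDegree Fin.zero (bound u) (coeff u) (vanishes u) nz in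
    invert d (≉0 d nz′) bu
    where
    ≉0 : ∀ d → Nonzero (at Fin.zero d (coeff u)) → coeff u (d ∷ []) ≉ 0#
    ≉0 d ([] , u≉0) = u≉0
    invert : ∀ d → coeff u (d ∷ []) ≉ 0# → BoundedIn Fin.zero d (coeff u) →
             ∃[ d ] ∃[ a ] a ≉ 0# × IsMonic d (scale a u) × coeff u (d ∷ []) ≉ 0#
    invert d u≉0 bu = let (a , ua≈1) = inverse _ u≉0 in
      d , a ,
      (λ a≈0 → 1≉0 (trans (sym ua≈1) (trans (*-congˡ a≈0) (zeroʳ _)))) ,
      monic⁺ (trans (*-comm a _) ua≈1) (λ n d<n → trans (*-congˡ (bu n d<n [])) (zeroʳ a)) ,
      u≉0

  infix 4 _∣₁_
  _∣₁_ : Poly 1 → Poly 1 → Set (c ⊔ ℓ)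
  u ∣₁ v = ∃[ w ] v ≃ u *ₚ w

  -- If `w` has top degree t, the coefficient of `u *ₚ w` at d + t is the leading coefficient of
  -- `w`, and nothing lies above. Comparison with the monic `v` leaves only s = d + t and leading
  -- coefficient 1.
  monic-quotient : ∀ {d s u v} w → IsMonic d u → IsMonic s v → v ≃ u *ₚ w →
                   ∃[ t ] IsMonic t w × s ≡ d ℕ.+ t
  monic-quotient {d} {s} {u} {v} w mu mv v≃uw =
    let nz = Nonzero-*⁻ʳ u w (Nonzero-cong {f = coeff v} {coeff (u *ₚ w)} (≃⁻ v≃uw) (monic-Nonzero mv))
        (t , nz′ , bw) = leadingDegree Fin.zero (bound w) (coeff w) (vanishes w) nz
    in go t nz′ bw
    where
    muw : IsMonic s (u *ₚ w)
    muw = monic-resp-≃ v≃uw mv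
    go : ∀ t → Nonzero (at Fin.zero t (coeff w)) → BoundedIn Fin.zero t (coeff w) →
         ∃[ t ] IsMonic t w × s ≡ d ℕ.+ t
    go t ([] , wₜ≉0) bw with ℕ.<-cmp s (d ℕ.+ t)
    ... | tri< s<d+t _ _ =
      ⊥-elim (wₜ≉0 (trans (sym (coeff-* {u = u} {w} mu bw)) (above muw _ s<d+t)))
    ... | tri≈ _ ≡.refl _ = t ,
      monic⁺ (trans (sym (coeff-* {u = u} {w} mu bw)) (leading muw))
        (λ n t<n → bw n t<n []) , ≡.refl
    ... | tri> _ _ d+t<s =
      ⊥-elim (1≉0 (trans (sym (leading muw)) (bounded-* {u = u} {w} mu bw s d+t<s [])))

  mapRows : ∀ p → (Coefficients 1 → Coefficients 1) → Coefficients (suc p) → Coefficients (suc p)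
  mapRows zero    φ f         = φ f
  mapRows (suc p) φ f (n ∷ v) = mapRows p φ (slice n f) v

  row-mapRows : ∀ {p} (e : Vec ℕ p) φ f → row e (mapRows p φ f) ≋ φ (row e f)
  row-mapRows []      φ f _ = refl
  row-mapRows (n ∷ e) φ f   = row-mapRows e φ (slice n f)

  mapRows-zero : ∀ p φ → (∀ u → (∀ e → u e ≈ 0#) → ∀ e → φ u e ≈ 0#) →
                 ∀ f → (∀ e → f e ≈ 0#) → ∀ e → mapRows p φ f e ≈ 0#
  mapRows-zero zero    φ φ0 f f≈0 e       = φ0 f f≈0 e
  mapRows-zero (suc p) φ φ0 f f≈0 (n ∷ e) = mapRows-zero p φ φ0 (slice n f) (λ _ → f≈0 _) e

  mapRows-vanishes : ∀ p φ {b b′} → b ≤ b′ → (∀ u → (∀ e → u e ≈ 0#) → ∀ e → φ u e ≈ 0#) →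
                     (∀ u → VanishesBeyond b u → VanishesBeyond b′ (φ u)) →
                     ∀ f → VanishesBeyond b f → VanishesBeyond b′ (mapRows p φ f)
  mapRows-vanishes zero    φ b≤b′ φ0 φv f v                    = φv f v
  mapRows-vanishes (suc p) φ b≤b′ φ0 φv f v (n ∷ e) (here b′<n) =
    mapRows-zero p φ φ0 (slice n f) (λ _ → v _ (here (ℕ.≤-<-trans b≤b′ b′<n))) e
  mapRows-vanishes (suc p) φ b≤b′ φ0 φv f v (n ∷ e) (there b′<e) =
    mapRows-vanishes p φ b≤b′ φ0 φv (slice n f) (λ e b<e → v (n ∷ e) (there b<e)) e b′<e

  -- The monomial uₙ xˢ. For n = d + s it is the next quotient term when dividing by a monic
  -- polynomial of degree d.
  move : ℕ → ℕ → Coefficients 1 → Coefficients 1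
  move n s u (j ∷ []) with j ℕ.≟ s
  ... | yes _ = u (n ∷ [])
  ... | no  _ = 0#

  move-zero : ∀ n s u → (∀ e → u e ≈ 0#) → ∀ e → move n s u e ≈ 0#
  move-zero n s u u≈0 (j ∷ []) with j ℕ.≟ s
  ... | yes _ = u≈0 _
  ... | no  _ = refl

  move-bounded : ∀ n s u → BoundedIn Fin.zero s (move n s u)
  move-bounded n s u j s<j [] with j ℕ.≟ s
  ... | yes ≡.refl = ⊥-elim (ℕ.<-irrefl ≡.refl s<j)
  ... | no  _      = refl

  move-≡ : ∀ n s u → move n s u (s ∷ []) ≡ u (n ∷ [])
  move-≡ n s u with s ℕ.≟ s
  ... | yes _  = ≡.refl
  ... | no s≢s = ⊥-elim (s≢s ≡.refl)

  moveₚ : ∀ {p} → ℕ → ℕ → Poly (suc p) → Poly (suc p)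
  moveₚ {p} n s f = mkPoly (mapRows p (move n s) (coeff f)) (bound f ℕ.+ s)
    (mapRows-vanishes p (move n s) (ℕ.m≤m+n _ s) (move-zero n s)
      (λ { u _ (j ∷ []) (here b+s<j) → move-bounded n s u j (ℕ.≤-<-trans (ℕ.m≤n+m s _) b+s<j) [] })
      (coeff f) (vanishes f))

  -- Division with remainder on all rows, and the content

  RowsBelow : ∀ {p} → ℕ → Poly (suc p) → Set ℓ
  RowsBelow n f = ∀ e j → n ≤ j → coeff (rowₚ e f) (j ∷ []) ≈ 0#

  record Division {p} (d : ℕ) (u : Poly 1) (f : Poly (suc p)) : Set (c ⊔ ℓ) where
    constructor division⁺
    field
      {quotient remainder} : Poly (suc p)
      f≃  : f ≃ u • quotient +ₚ remainder
      low : RowsBelow d remainder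

  rowₚ-neg : ∀ {p} (e : Vec ℕ p) (f : Poly (suc p)) → rowₚ e (-ₚ f) ≃ -ₚ rowₚ e f
  rowₚ-neg e f = ≃⁺ (row-neg e (coeff f))

  rowₚ-+ : ∀ {p} (e : Vec ℕ p) (f g : Poly (suc p)) → rowₚ e (f +ₚ g) ≃ rowₚ e f +ₚ rowₚ e g
  rowₚ-+ e f g = ≃⁺ (row-⊞ e (coeff f) (coeff g))

  +-cancel : ∀ {k} (x y : Poly k) → x +ₚ (y +ₚ -ₚ x) ≃ y
  +-cancel x y = R.trans (R.+-cong (R.refl {x = x}) (R.+-comm y (-ₚ x)))
    (R.trans (R.sym (R.+-assoc x (-ₚ x) y))
      (R.trans (R.+-cong (R.-‿inverseʳ x) (R.refl {x = y})) (R.+-identityˡ y)))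

  -- Long division in the last variable, carried out in all rows simultaneously; s bounds the number
  -- of quotient terms. As `u` is monic, subtracting `u • T` removes the coefficient of x ^ (d + s)
  -- from every row and creates nothing above it.
  divide-bounded : ∀ {p d u} → IsMonic d u → ∀ s (f : Poly (suc p)) → RowsBelow (d ℕ.+ s) f →
                   Division d u f
  divide-bounded {p} {d} {u} mu zero f f<n = division⁺ {quotient = 0ₚ} {f}
    (R.sym (R.trans (R.+-cong (R.zeroʳ (embedₚ u)) (R.refl {x = f})) (R.+-identityˡ f)))
    λ e j d≤j → f<n e j (ℕ.≤-trans (ℕ.≤-reflexive (ℕ.+-identityʳ d)) d≤j)
  divide-bounded {p} {d} {u} mu (suc s) f f<n = combine (divide-bounded mu s f′ f′<d+s)
    where
    T : Poly (suc p)
    T = moveₚ (d ℕ.+ s) s f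
    f′ : Poly (suc p)
    f′ = f +ₚ -ₚ (u • T)
    row-T : ∀ e j → coeff (rowₚ e T) (j ∷ []) ≈ move (d ℕ.+ s) s (row e (coeff f)) (j ∷ [])
    row-T e j = row-mapRows e (move (d ℕ.+ s) s) (coeff f) (j ∷ [])
    bounded-T : ∀ e → BoundedIn Fin.zero s (coeff (rowₚ e T))
    bounded-T e j s<j [] = trans (row-T e j) (move-bounded (d ℕ.+ s) s (row e (coeff f)) j s<j [])
    row-f′ : ∀ e j →
             coeff (rowₚ e f′) (j ∷ []) ≈
             coeff (rowₚ e f) (j ∷ []) + - coeff (u *ₚ rowₚ e T) (j ∷ [])
    row-f′ e j = trans (≃⁻ (rowₚ-+ e f (-ₚ (u • T))) (j ∷ []))
      (+-congˡ (trans (≃⁻ (rowₚ-neg e (u • T)) (j ∷ [])) (-‿cong (≃⁻ (row-• e u T) (j ∷ [])))))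
    f′<d+s : RowsBelow (d ℕ.+ s) f′
    f′<d+s e j d+s≤j with ℕ.m≤n⇒m<n∨m≡n d+s≤j
    ... | inj₁ d+s<j = trans (row-f′ e j) (trans (+-cong
      (f<n e j (ℕ.≤-trans (ℕ.≤-reflexive (ℕ.+-suc d s)) d+s<j))
      (trans (-‿cong (bounded-* {u = u} {rowₚ e T} mu (bounded-T e) j d+s<j [])) (-0#≈0# ring)))
        (+-identityʳ 0#))
    ... | inj₂ ≡.refl = trans (row-f′ e j) (trans (+-congˡ (-‿cong
      (trans (coeff-* {u = u} {rowₚ e T} mu (bounded-T e))
        (trans (row-T e s) (reflexive (move-≡ (d ℕ.+ s) s (row e (coeff f)))))))) (-‿inverseʳ _))
    combine : Division d u f′ → Division d u f
    combine (division⁺ {Q} {S} f′≃ low) = division⁺ {quotient = T +ₚ Q} {S}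
      (R.sym (R.trans (R.+-cong (R.distribˡ (embedₚ u) T Q) (R.refl {x = S}))
        (R.trans (R.+-assoc (u • T) (u • Q) S)
          (R.trans (R.+-cong (R.refl {x = u • T}) (R.sym f′≃)) (+-cancel (u • T) f)))))
      low

  divide : ∀ {p d u} → IsMonic d u → (f : Poly (suc p)) → Division d u f
  divide {d = d} mu f = divide-bounded mu (suc (bound f)) f λ e j d+b<j →
    row-vanishes e (vanishes f) (j ∷ []) (here (ℕ.≤-trans (ℕ.m≤n+m _ d) d+b<j))

  -- The content of f, characterised as a greatest common divisor of its rows.
  record Content {p} (f : Poly (suc p)) : Set (c ⊔ ℓ) where
    constructor content⁺
    field
      {degree}  : ℕ
      {content} : Poly 1
      {part}    : Poly (suc p)
      monic     : IsMonic degree content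
      f≃        : f ≃ content • part
      universal : ∀ {d D h} → IsMonic d D → f ≃ D • h → D ∣₁ content

  ∣₁-scale : ∀ {D u} a → D ∣₁ u → D ∣₁ scale a u
  ∣₁-scale {D} a (w , u≃Dw) = scale a w , R.trans (scale-cong a u≃Dw) (R.sym (scale-*ʳ a D w))

  -- Euclid's algorithm on all rows at once: as long as some remainder of the
  -- rows modulo u is nonzero, it replaces u.
  content-exists : ∀ {p} (f : Poly (suc p)) → Nonzeroₚ f → Content f
  content-exists {p} f nz = let (e , nzₑ) = row-Nonzero nz
                                (d , a , _ , ma , _) = normalise (rowₚ e f) nzₑ in
    -- The start is any nonzero row, made monic: a common divisor of all rows divides it. The degree
    -- falls strictly in each round, so `suc d` rounds are enough.
    euclid (suc d) ma (ℕ.≤-refl) λ {D = D} {h} mD f≃Dh →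
      ∣₁-scale a (rowₚ e h , R.trans (rowₚ-cong e f≃Dh) (row-• e D h))
    where
    Universal : Poly 1 → Set (c ⊔ ℓ)
    Universal u = ∀ {d D h} → IsMonic d D → f ≃ D • h → D ∣₁ u
    euclid : ∀ N {d u} → IsMonic d u → d < N → Universal u → Content f
    step : ∀ N {d u} → IsMonic d u → d < suc N → Universal u →
           (div : Division d u f) → Dec (Nonzeroₚ (Division.remainder div)) → Content f
    euclid (suc N) mu d<N univ = let div = divide mu f in
      step N mu d<N univ div (nonzeroₚ? (Division.remainder div))
    step N {u = u} mu d<N univ (division⁺ {Q} {S} f≃ low) (no ¬nz) = content⁺ mu
      (R.trans f≃
        (R.trans (R.+-cong (R.refl {x = u • Q}) (¬Nonzero⇒≃0 S ¬nz)) (R.+-identityʳ (u • Q)))) univ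
    step N {d} {u} mu d<N univ (division⁺ {Q} {S} f≃ low) (yes nz) =
      let (e , nzₑ) = row-Nonzero nz
          (d′ , a , _ , ma , S≉0) = normalise (rowₚ e S) nzₑ
          d′<d = ℕ.≰⇒> λ d≤d′ → S≉0 (low e d′ d≤d′)
      in euclid N ma (ℕ.≤-trans d′<d (ℕ.s≤s⁻¹ d<N)) λ {D = D} {h} mD f≃Dh →
        -- `D` divides `u` by the invariant and every row of `f` by assumption, hence also every row
        -- of the remainder f - u • Q. The row that replaces `u` therefore keeps the invariant.
        ∣₁-scale a (let (w , u≃Dw) = univ mD f≃Dh in
          rowₚ e h +ₚ -ₚ (w *ₚ rowₚ e Q) , remainder-divisible e D h w f≃Dh u≃Dw)
      where
      remainder-divisible : ∀ e D h w → f ≃ D • h → u ≃ D *ₚ w →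
                            rowₚ e S ≃ D *ₚ (rowₚ e h +ₚ -ₚ (w *ₚ rowₚ e Q))
      remainder-divisible e D h w f≃Dh u≃Dw =
        R.sym (R.trans (R.distribˡ D (rowₚ e h) (-ₚ (w *ₚ rowₚ e Q)))
        (R.trans (R.+-cong (R.sym (R.trans (rowₚ-cong e f≃Dh) (row-• e D h)))
                           (R.trans (R.sym (-‿distribʳ-* R.ring D (w *ₚ rowₚ e Q)))
                             (R.-‿cong (R.trans (R.sym (R.*-assoc D w (rowₚ e Q)))
                               (R.*-cong (R.sym u≃Dw) (R.refl {x = rowₚ e Q}))))))
          (R.trans (R.+-cong (R.trans (rowₚ-cong e f≃) (R.trans (rowₚ-+ e (u • Q) S)
                      (R.+-cong (row-• e u Q) (R.refl {x = rowₚ e S}))))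
                        (R.refl {x = -ₚ (u *ₚ rowₚ e Q)}))
            (R.trans (R.+-assoc (u *ₚ rowₚ e Q) (rowₚ e S) (-ₚ (u *ₚ rowₚ e Q)))
              (+-cancel (u *ₚ rowₚ e Q) (rowₚ e S))))))

  -- Primitive polynomials and uniqueness of the decomposition

  Primitive : ∀ {p} → Poly (suc p) → Set (c ⊔ ℓ)
  Primitive g = ∀ {d D h} → IsMonic d D → g ≃ D • h → d ≡ 0

  record Decomposition {p} (f : Poly (suc p)) : Set (c ⊔ ℓ) where
    constructor decomposition⁺
    field
      {degree}  : ℕ
      {content} : Poly 1
      {part}    : Poly (suc p)
      monic     : IsMonic degree content
      isPrimitive : Primitive part
      f≃        : f ≃ content • part

  -- If `D` divides the part left after removing the content u, then u D divides `f`, hence divides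
  -- u by universality. Comparing degrees leaves degree 0 for `D`.
  decompose : ∀ {p} (f : Poly (suc p)) → Nonzeroₚ f → Decomposition f
  decompose f nz = build (content-exists f nz)
    where
    build : Content f → Decomposition f
    build (content⁺ {d} {u} {g} mu f≃ug univ) = decomposition⁺ mu prim f≃ug
      where
      prim : Primitive g
      prim {s} {D} {h} mD g≃Dh =
        let (w , u≃uDw) = univ (monic-* mu mD)
              (R.trans f≃ug
                (R.trans (R.*-cong (R.refl {x = embedₚ u}) g≃Dh) (R.sym (•-assoc u D h))))
            (t , _ , d≡) = monic-quotient w (monic-* mu mD) mu u≃uDw
        in ℕ.m+n≡0⇒m≡0 s (ℕ.+-cancelˡ-≡ d (s ℕ.+ t) 0
             (≡.trans (≡.sym (ℕ.+-assoc d s t)) (≡.trans (≡.sym d≡) (≡.sym (ℕ.+-identityʳ d)))))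

  embed-Nonzero : ∀ p u → Nonzero u → Nonzero (embed p u)
  embed-Nonzero zero    u nz = nz
  embed-Nonzero (suc p) u nz = let (e , ue≉0) = embed-Nonzero p u nz in 0 ∷ e , ue≉0

  •-cancelˡ : ∀ {p d u} {g h : Poly (suc p)} → IsMonic d u → u • g ≃ u • h → g ≃ h
  •-cancelˡ {p} {u = u} {g} {h} mu = *ₚ-cancelˡ (embedₚ u) g h
    (embed-Nonzero p (coeff u) (monic-Nonzero mu))

  -- By universality `u` divides the content, say with quotient w. Cancelling `u` shows that w
  -- divides the primitive `g`, so w has degree 0 and, being monic, is 1.
  content-of-primitive : ∀ {p d u} {f g : Poly (suc p)} → IsMonic d u → Primitive g → f ≃ u • g →
                         (C : Content f) → Content.content C ≃ u
  content-of-primitive {u = u} {f} {g} mu prim f≃ug (content⁺ {D} {C} {G} mC f≃CG univ) =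
    let (w , C≃uw) = univ mu f≃ug
        (t , mw , _) = monic-quotient w mu mC C≃uw
        g≃wG = •-cancelˡ mu
          (R.trans (R.sym f≃ug)
            (R.trans f≃CG (R.trans (•-cong C≃uw (R.refl {x = G})) (•-assoc u w G))))
        t≡0 = prim mw g≃wG
    in R.trans C≃uw (R.trans
         (R.*-cong (R.refl {x = u}) (monic-0 (≡.subst (λ t → IsMonic t w) t≡0 mw)))
         (R.*-identityʳ u))

  decomposition-unique : ∀ {p d u d′ u′} {g g′ : Poly (suc p)} → IsMonic d u → IsMonic d′ u′ →
    Primitive g → Primitive g′ → Nonzeroₚ (u • g) → u • g ≃ u′ • g′ → u ≃ u′ × g ≃ g′
  decomposition-unique {u = u} {u′ = u′} {g} {g′} mu mu′ prim prim′ nz ug≃u′g′ =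
    u≃u′ , •-cancelˡ mu (R.trans ug≃u′g′ (•-cong (R.sym u≃u′) (R.refl {x = g′})))
    where
    C = content-exists (u • g) nz
    u≃u′ : u ≃ u′
    u≃u′ = R.trans (R.sym (content-of-primitive mu prim (R.refl {x = u • g}) C))
                   (content-of-primitive mu′ prim′ ug≃u′g′ C)

  scale-scale⁻¹ : ∀ {k} a b → a * b ≈ 1# → (f : Poly k) → scale a (scale b f) ≃ f
  scale-scale⁻¹ a b ab≈1 f =
    ≃⁺ λ e → trans (sym (*-assoc a b _)) (trans (*-congʳ ab≈1) (*-identityˡ _))

  scale⁻¹-scale : ∀ {k a} b → a * b ≈ 1# → (f : Poly k) → scale b (scale a f) ≃ f
  scale⁻¹-scale b ab≈1 = scale-scale⁻¹ b _ (trans (*-comm b _) ab≈1)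

  embed-scale : ∀ {p} a u → embedₚ {p} (scale a u) ≃ scale a (embedₚ u)
  embed-scale {p} a u = ≃⁺ (go p)
    where
    go : ∀ p e → embed p (λ v → a * coeff u v) e ≈ a * embed p (coeff u) e
    go zero    e           = refl
    go (suc p) (zero ∷ e)  = go p e
    go (suc p) (suc _ ∷ e) = sym (zeroʳ a)

  embed-at : ∀ p u j → embed p u (replicate p 0 ∷ʳ j) ≡ u (j ∷ [])
  embed-at zero    u j = ≡.refl
  embed-at (suc p) u j = embed-at p u j

  embed-support : ∀ p u v → embed p u v ≉ 0# → ∃[ j ] v ≡ replicate p 0 ∷ʳ j × u (j ∷ []) ≉ 0#
  embed-support zero    u (j ∷ [])     u≉0 = j , ≡.refl , u≉0
  embed-support (suc p) u (zero ∷ v)   u≉0 = let (j , v≡ , uⱼ≉0) = embed-support p u v u≉0 in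
    j , ≡.cong (0 ∷_) v≡ , uⱼ≉0
  embed-support (suc p) u (suc _ ∷ v) u≉0 = ⊥-elim (u≉0 refl)

  Nonzero-embed : ∀ p u → Nonzero (embed p u) → Nonzero u
  Nonzero-embed p u (v , uv≉0) = let (j , _ , uⱼ≉0) = embed-support p u v uv≉0 in j ∷ [] , uⱼ≉0

  Primitive-scale : ∀ {p a} {g : Poly (suc p)} → a ≉ 0# → Primitive g → Primitive (scale a g)
  Primitive-scale {a = a} {g} a≉0 prim {d} {D} {h} mD ag≃Dh = let (b , ab≈1) = inverse a a≉0 in
    prim mD (R.trans (R.sym (scale⁻¹-scale b ab≈1 g))
      (R.trans (scale-cong b ag≃Dh) (R.sym (scale-•ʳ b D h))))

  -- The scalar relating the two products can be moved into the primitive part, where it does not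
  -- affect primitivity. The monic contents then agree exactly.
  decomposition-unique-≅ : ∀ {p d u d′ u′} {g g′ : Poly (suc p)} → IsMonic d u → IsMonic d′ u′ →
    Primitive g → Primitive g′ → Nonzeroₚ (u • g) → u • g ≅ u′ • g′ → u ≃ u′ × g ≅ g′
  decomposition-unique-≅ {u = u} {u′ = u′} {g} {g′} mu mu′ prim prim′ nz (≅⁺ (a , a≉0 , ug≈au′g′)) =
    let (u≃u′ , g≃ag′) = decomposition-unique {g′ = scale a g′} mu mu′ prim (Primitive-scale a≉0 prim′) nz
          (R.trans (≃⁺ {g = scale a (u′ • g′)} ug≈au′g′) (R.sym (scale-•ʳ a u′ g′)))
    in u≃u′ , ≅-trans (≃⇒≅ g≃ag′) (scale-≅ g′ a≉0)

  Deg-embed : ∀ {p d u} → IsMonic d u → Deg (replicate p 0 ∷ʳ d) (embedₚ {p} u)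
  Deg-embed {p} {d} {u} mu = deg⁺ λ i →
    (replicate p 0 ∷ʳ d , ≡.refl , λ u≈0 →
      1≉0 (trans (sym (leading mu)) (trans (reflexive (≡.sym (embed-at p (coeff u) d))) u≈0))) ,
    λ v uv≉0 → let (j , v≡ , uⱼ≉0) = embed-support p (coeff u) v uv≉0 in
      ≡.subst (λ v → lookup v i ≤ lookup (replicate p 0 ∷ʳ d) i) (≡.sym v≡)
        (lookup-∷ʳ-mono (replicate p 0) (ℕ.≮⇒≥ λ d<j → uⱼ≉0 (above mu j d<j)) i)

  Deg-• : ∀ {p d u} {g : Poly (suc p)} m {t} → IsMonic d u → Deg (m ∷ʳ t) g →
          Deg (m ∷ʳ (d ℕ.+ t)) (u • g)
  Deg-• {p} {d} {u} {g} m {t} mu dg =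
    ≡.subst (λ m → Deg m (u • g)) (replicate-∷ʳ-⊕ m d t) (Deg-* (Deg-embed mu) dg)

  Deg-•⁻ : ∀ {p d u} {g : Poly (suc p)} m {n} → IsMonic d u → Deg (m ∷ʳ n) (u • g) →
           ∃[ t ] Deg (m ∷ʳ t) g × n ≡ d ℕ.+ t
  Deg-•⁻ {p} {d} {u} {g} m {n} mu dug =
    let (b , db) = Deg-exists g (Nonzero-*⁻ʳ (embedₚ u) g (Deg⇒Nonzero dug)) in go (initLast b) db
    where
    go : ∀ {b} → (∃[ b′ ] ∃[ t ] b ≡ b′ ∷ʳ t) → Deg b g → ∃[ t ] Deg (m ∷ʳ t) g × n ≡ d ℕ.+ t
    go (b , t , ≡.refl) db = let (b≡m , d+t≡n) = ∷ʳ-injective b m (Deg-unique (Deg-• b mu db) dug) in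
      t , ≡.subst (λ b → Deg (b ∷ʳ t) g) b≡m db , ≡.sym d+t≡n

  -- Removing and restoring the constant term of a content

  lower : Poly 1 → Poly 1
  lower u = mkPoly (shift (coeff u)) (bound u) λ
    { (n ∷ []) (here b<n) → vanishes u (suc n ∷ []) (here (ℕ.m≤n⇒m≤1+n b<n)) }

  raise : Carrier → Poly 1 → Poly 1
  raise a u = mkPoly (λ { (zero ∷ []) → a ; (suc n ∷ []) → coeff u (n ∷ []) }) (suc (bound u))
    λ { (suc n ∷ []) (here (s≤s b<n)) → vanishes u (n ∷ []) (here b<n) }

  monic-lower : ∀ {d u} → IsMonic (suc d) u → IsMonic d (lower u)
  monic-lower mu = monic⁺ (leading mu) λ n d<n → above mu (suc n) (s≤s d<n)

  monic-raise : ∀ {d} a {u} → IsMonic d u → IsMonic (suc d) (raise a u)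
  monic-raise a mu = monic⁺ (leading mu) λ { (suc n) (s≤s d<n) → above mu n d<n }

  lower-injective : ∀ {u v} → coeff u (0 ∷ []) ≈ coeff v (0 ∷ []) → lower u ≃ lower v → u ≃ v
  lower-injective u₀≈v₀ (≃⁺ l) = ≃⁺ λ { (zero ∷ []) → u₀≈v₀ ; (suc n ∷ []) → l (n ∷ []) }

  raise-injective : ∀ {a b u v} → raise a u ≃ raise b v → a ≈ b × u ≃ v
  raise-injective (≃⁺ r) = r (0 ∷ []) , ≃⁺ λ { (n ∷ []) → r (suc n ∷ []) }

  embed-row : ∀ p d (x : Coefficients (suc p)) → BoundedBy (replicate p 0 ∷ʳ d) x →
              embed p (row (replicate p 0) x) ≋ x
  embed-row zero    d x bx v           = refl
  embed-row (suc p) d x bx (zero ∷ v)  =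
    embed-row p d (slice 0 x) (λ i v → bx (Fin.suc i) (0 ∷ v)) v
  embed-row (suc p) d x bx (suc n ∷ v) = sym (bx Fin.zero (suc n ∷ v) (s≤s z≤n))

  -- Such an `x` involves only the last variable, so it is the embedding of its row at exponents 0.
  -- Made monic, that row divides `f`, and primitivity forces degree 0. Nonunit factors of a
  -- primitive polynomial must thus involve one of the other variables.
  Primitive-factor : ∀ {p} {f x y : Poly (suc p)} d → Primitive f → Nonzeroₚ f → f ≃ x *ₚ y →
                     Deg (replicate p 0 ∷ʳ d) x → Unit x
  Primitive-factor {p} {f} {x} {y} d prim nz f≃xy dx = go (normalise u nzu)
    where
    u : Poly 1
    u = rowₚ (replicate p 0) x
    x≃u : x ≃ embedₚ u
    x≃u = R.sym
      (≃⁺ (embed-row p d (coeff x) (Deg⇒BoundedBy {m = replicate p 0 ∷ʳ d} dx λ _ → ℕ.≤-refl)))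
    nzu : Nonzeroₚ u
    nzu = Nonzero-embed p (coeff u)
      (Nonzero-cong {f = coeff x} {embed p (coeff u)} (≃⁻ x≃u) (Deg⇒Nonzero dx))
    go : (∃[ d ] ∃[ a ] a ≉ 0# × IsMonic d (scale a u) × coeff u (d ∷ []) ≉ 0#) → Unit x
    go (s , a , a≉0 , mu , _) = let (b , ab≈1) = inverse a a≉0 in
      Deg-0⇒Unit (≡.subst (λ m → Deg m x) (replicate-∷ʳ p 0)
        (≡.subst (λ s → Deg (replicate p 0 ∷ʳ s) x) (prim mu (f≃ b ab≈1))
          (Deg-resp-≅
            (≅-sym (≅-trans (≃⇒≅ x≃u)
              (≅-sym (≅-trans (≃⇒≅ (embed-scale a u)) (scale-≅ (embedₚ u) a≉0)))))
            (Deg-embed mu))))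
      where
      f≃ : ∀ b → a * b ≈ 1# → f ≃ scale a u • scale b y
      f≃ b ab≈1 = R.trans f≃xy (R.trans (R.*-cong x≃u (R.refl {x = y})) (R.sym
        (R.trans (R.*-cong (embed-scale a u) (R.refl {x = scale b y}))
        (R.trans (scale-*ˡ a (embedₚ u) (scale b y))
        (R.trans (scale-cong a (scale-*ʳ b (embedₚ u) y)) (scale-scale⁻¹ a b ab≈1 (u • y)))))))

  -- Reducible primitive polynomials and the comparison of the counts

  module Classes {k : ℕ} {p : Level} {P : Pred (Poly k) p} {n : ℕ} (counted : NumberOfNormalized P n) where

    open Inverse counted

    class : ∀ f → P f → Fin n
    class f Pf = to (f , Pf)

    class-injective : ∀ {f g} {Pf : P f} {Pg : P g} → class f Pf ≡ class g Pg → f ≅ g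
    class-injective {f} {g} {Pf} {Pg} eq = ≅-trans
      (≅-sym {f = proj₁ (from (to (f , Pf)))} (≅⁺ (strictlyInverseʳ (f , Pf))))
      (≅⁺ (≡.subst (λ i → proj₁ (from i) ∼ g) (≡.sym eq) (strictlyInverseʳ (g , Pg))))

    representative : Fin n → Poly k
    representative i = proj₁ (from i)

    representative-P : ∀ i → P (representative i)
    representative-P i = proj₂ (from i)

    representative-injective : ∀ {i j} → representative i ≅ representative j → i ≡ j
    representative-injective {i} {j} (≅⁺ eq) =
      ≡.trans (≡.sym (strictlyInverseˡ i)) (≡.trans (to-cong eq) (strictlyInverseˡ j))

  •-≅ : ∀ {p u u′} {g g′ : Poly (suc p)} → u ≃ u′ → g ≅ g′ → u • g ≅ u′ • g′
  •-≅ {u = u} {u′} {g} {g′} u≃u′ (≅⁺ (a , a≉0 , g≈ag′)) = ≅-trans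
    (≃⇒≅ (R.trans (•-cong u≃u′ (≃⁺ {g = scale a g′} g≈ag′)) (scale-•ʳ a u′ g′)))
    (scale-≅ (u′ • g′) a≉0)

  Splits-resp-≅ : ∀ {k} {f g : Poly k} → f ≅ g → Splits g → Splits f
  Splits-resp-≅ {f = f} {g} (≅⁺ (a , a≉0 , f≈ag)) (splits⁺ {x} {y} g≃xy ¬ux ¬uy) =
    splits⁺ {x = x} {scale a y}
    (R.trans (≃⁺ {g = scale a g} f≈ag) (R.trans (scale-cong a g≃xy) (R.sym (scale-*ʳ a x y)))) ¬ux
    λ { (RawMagma._,_ h h[ay]≈1) → ¬uy (RawMagma._,_ (scale a h)
      (≃⁻ (R.trans (R.trans (scale-*ˡ a h y) (R.sym (scale-*ʳ a h y)))
        (≃⁺ {f = h *ₚ scale a y} {1ₚ} h[ay]≈1)))) }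

  -- Speaks of the degrees in all variables but the last. Comparing box sizes fixes the order of the
  -- two factors, and the exponent estimate relies on that order.
  PrefixAdmissible : ∀ {r} → Vec ℕ r → Vec ℕ r → Set
  PrefixAdmissible a b = 0 < sum a × 0 < sum b × boxSize a ≤ boxSize b

  Admissible : ∀ {r} → Vec ℕ (2 ℕ.+ r) → Vec ℕ (2 ℕ.+ r) → Set
  Admissible a b = PrefixAdmissible (init a) (init b)

  Admissible-∷ʳ : ∀ {r} (a b : Vec ℕ (suc r)) j l → Admissible (a ∷ʳ j) (b ∷ʳ l) →
                  PrefixAdmissible a b
  Admissible-∷ʳ a b j l = ≡.subst₂ PrefixAdmissible (init-∷ʳ j a) (init-∷ʳ l b)

  admissible? : ∀ {r} (a b : Vec ℕ (2 ℕ.+ r)) → Dec (Admissible a b)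
  admissible? a b = (0 ℕ.<? sum (init a)) ×-dec
    ((0 ℕ.<? sum (init b)) ×-dec (boxSize (init a) ℕ.≤? boxSize (init b)))

  block : ∀ {r} (a b : Vec ℕ (2 ℕ.+ r)) → Dec (Admissible a b) → List (Poly (2 ℕ.+ r))
  block a b (yes _) = cartesianProductWith _*ₚ_ (polys a) (polys b)
  block a b (no _)  = []

  products : ∀ {r} → Vec ℕ (2 ℕ.+ r) → List (Poly (2 ℕ.+ r))
  products m = concatMap (λ (a , b) → block a b (admissible? a b)) (splits m)

  -- A pair (a , b) contributes q ^ boxSize a times q ^ boxSize b products, at most q ^ E / 2 ^ sum
  -- a by `exponent-bound`. Each of the 2 + r variables then costs a factor 2 for its geometric
  -- series.
  length-products : ∀ {r} m₁ (ms : Vec ℕ r) n → 2 ≤ q → 1 ≤ n →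
    All (_≤ m₁) (m₁ ∷ ms) → 3 ≤ m₁ ℕ.* boxSize ms →
    length (products ((m₁ ∷ ms) ∷ʳ n)) ≤ 2 ^ (2 ℕ.+ r) ℕ.* q ^ (m₁ ℕ.* boxSize (ms ∷ʳ n) ℕ.+ 4)
  length-products {r} m₁ ms n 2≤q 1≤n m≤ 3≤M = ℕ.≤-trans
    (ℕ.≤-reflexive (length-concatMap _ (splits m)))
    (total-splits m (q ^ E) _ λ a b a⊕b≡m → bound-block a b a⊕b≡m (initLast a) (initLast b)
      (admissible? a b))
    where
    m = (m₁ ∷ ms) ∷ʳ n
    E = m₁ ℕ.* boxSize (ms ∷ʳ n) ℕ.+ 4
    bound-block : ∀ a b → a ⊕ b ≡ m → (∃[ a′ ] ∃[ j ] a ≡ a′ ∷ʳ j) → (∃[ b′ ] ∃[ l ] b ≡ b′ ∷ʳ l) →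
                  (t : Dec (Admissible a b)) → length (block a b t) ℕ.* 2 ^ sum a ≤ q ^ E
    bound-block a b _ _ _ (no _) = z≤n
    bound-block a b eq (a′ , j , ≡.refl) (b′ , l , ≡.refl) (yes t) = ℕ.≤-trans
      (ℕ.≤-reflexive (≡.cong (ℕ._* 2 ^ sum a)
        (≡.trans (length-cartesianProductWith _*ₚ_ (polys a) (polys b))
          (≡.cong₂ ℕ._*_ (length-polys a) (length-polys b)))))
      (power-bound (boxSize a) (boxSize b) (sum a) 2≤q
        (≡.subst (λ n → boxSize a ℕ.+ boxSize b ℕ.+ sum a ≤ m₁ ℕ.* boxSize (ms ∷ʳ n) ℕ.+ 4) j+l≡n
          (exponent-bound m₁ ms a′ b′ j l a′+b′≡ m≤ 3≤M
            (≡.subst (1 ≤_) (≡.sym j+l≡n) 1≤n) 0<a′ 0<b′ a′≤b′)))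
      where
      eqs = ∷ʳ-injective (a′ ⊕ b′) (m₁ ∷ ms) (≡.trans (≡.sym (⊕-∷ʳ a′ b′ j l)) eq)
      a′+b′≡ = proj₁ eqs
      j+l≡n = proj₂ eqs
      t′ = Admissible-∷ʳ a′ b′ j l t
      0<a′ = proj₁ t′
      0<b′ = proj₁ (proj₂ t′)
      a′≤b′ = proj₂ (proj₂ t′)

  -- By `Primitive-factor` neither factor has prefix degree 0. Exchanging the factors if necessary
  -- puts the smaller box first, so the pair of degrees is admissible.
  products-complete : ∀ {r} {m : Vec ℕ (2 ℕ.+ r)} {f} → Deg m f → Primitive f → Splits f →
                      ListAny.Any (f ≃_) (products m)
  products-complete {r} {m} {f} df prim (splits⁺ {x} {y} f≃xy ¬ux ¬uy) =
    let (a , b , da , db , a⊕b≡m) = Deg-factors df f≃xy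
        0<a = positive f≃xy ¬ux (initLast a) da
        0<b = positive f≃yx ¬uy (initLast b) db
    in [ (λ a≤b → covered a⊕b≡m f≃xy da db (0<a , 0<b , a≤b))
       , (λ b≤a → covered (≡.trans (⊕-comm b a) a⊕b≡m) f≃yx db da (0<b , 0<a , b≤a))
       ]′ (ℕ.≤-total (boxSize (init a)) (boxSize (init b)))
    where
    f≃yx : f ≃ y *ₚ x
    f≃yx = R.trans f≃xy (R.*-comm x y)
    positive : ∀ {x y a} → f ≃ x *ₚ y → ¬ Unit x → (∃[ a′ ] ∃[ j ] a ≡ a′ ∷ʳ j) → Deg a x →
               0 < sum (init a)
    positive {x} {y} f≃xy ¬ux (a′ , j , ≡.refl) dx =
      ≡.subst (λ a → 0 < sum a) (≡.sym (init-∷ʳ j a′)) (ℕ.n≢0⇒n>0 λ a′≡0 →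
      ¬ux (Primitive-factor {y = y} j prim (Deg⇒Nonzero df) f≃xy
        (≡.subst (λ a → Deg (a ∷ʳ j) x) (sum≡0⇒replicate a′ a′≡0) dx)))
    in-block : ∀ {x y a b} → f ≃ x *ₚ y → Deg a x → Deg b y → Admissible a b →
               (t : Dec (Admissible a b)) →
               ListAny.Any (f ≃_) (block a b t)
    in-block f≃xy dx dy t (no ¬t) = ⊥-elim (¬t t)
    in-block {x} {y} {a} {b} f≃xy dx dy _ (yes _) = ListAny.cartesianProductWith⁺ _*ₚ_
      (λ x≃x′ y≃y′ → R.trans f≃xy (R.*-cong x≃x′ y≃y′))
      (polys-complete a x (Deg⇒BoundedBy {m = a} dx λ _ → ℕ.≤-refl))
      (polys-complete b y (Deg⇒BoundedBy {m = b} dy λ _ → ℕ.≤-refl))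
    covered : ∀ {x y a b} → a ⊕ b ≡ m → f ≃ x *ₚ y → Deg a x → Deg b y → Admissible a b →
              ListAny.Any (f ≃_) (products m)
    covered {a = a} {b} a⊕b≡m f≃xy dx dy t = ≡.subst (λ m → ListAny.Any (f ≃_) (products m)) a⊕b≡m
      (ListAny.concatMap⁺ (λ (a , b) → block a b (admissible? a b))
        (ListAny.map (λ { ≡.refl → in-block f≃xy dx dy t (admissible? a b) }) (∈-splits a b)))

  -- Comparison of the three counts by two injections

  module Counting {r : ℕ} (m′ : Vec ℕ (suc r)) (0<m₁ : 0 < lookup m′ Fin.zero) (n : ℕ) where

    k : ℕ
    k = 2 ℕ.+ r

    0<m-head : ∀ t → 0 < lookup (m′ ∷ʳ t) Fin.zero
    0<m-head t = head-positive m′ 0<m₁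
      where
      head-positive : ∀ {r} (v : Vec ℕ (suc r)) → 0 < lookup v Fin.zero →
                      0 < lookup (v ∷ʳ t) Fin.zero
      head-positive (_ ∷ _) 0<x = 0<x

    m : Vec ℕ k
    m = m′ ∷ʳ suc n

    -- The cases only have to cover: `factored` and `imprimitive` may hold of the same `f`. For the
    -- upper bound on N any choice of a case will do, provided its code determines `f` up to a
    -- scalar.
    data Class (f : Poly k) : Set (c ⊔ ℓ) where
      irreducible : Irreducible f → Class f
      factored    : ListAny.Any (f ≃_) (products m) → Class f
      imprimitive : ∀ d u g → IsMonic (suc d) u → Primitive g → f ≃ u • g → Class f

    classify : ∀ f → Deg m f → Class f
    classify f df = [ irreducible , (λ s → byContent s (decompose f (Deg⇒Nonzero df))) ]′
      (irreducible⊎splits f df (¬Unit-Deg Fin.zero df (0<m-head (suc n))))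
      where
      byContent : Splits f → Decomposition f → Class f
      byContent s (decomposition⁺ {zero} {u} {g} mu prim f≃ug) = factored
        (products-complete df
          (λ mD f≃Dh → prim mD (R.trans (R.sym f≃g) f≃Dh)) s)
        where
        f≃g : f ≃ g
        f≃g = R.trans f≃ug (R.trans (•-cong (monic-0 mu) (R.refl {x = g})) (1-• g))
      byContent s (decomposition⁺ {suc d} {u} {g} mu prim f≃ug) = imprimitive d u g mu prim f≃ug

    module _ {I N N′ : ℕ} (countI : IsI F m I) (countN : IsN F m N) (countN′ : IsN F (m′ ∷ʳ n) N′) where

      private
        module CI  = Classes countI
        module CN  = Classes countN
        module CN′ = Classes countN′
        module E   = Inverse enumeration

      Code : Set
      Code = Fin I ⊎ (Fin (length (products m)) ⊎ (Fin q × Fin N′))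

      Deg-lower : ∀ {d u} {g : Poly k} → IsMonic (suc d) u → Deg m (u • g) →
                  Deg (m′ ∷ʳ n) (lower u • g)
      Deg-lower {d} {u} {g} mu dug = let (t , dg , 1+n≡) = Deg-•⁻ m′ mu dug in
        ≡.subst (λ n → Deg (m′ ∷ʳ n) (lower u • g)) (≡.sym (ℕ.suc-injective 1+n≡))
          (Deg-• m′ (monic-lower mu) dg)

      encode : ∀ f → Deg m f → Class f → Code
      encode f df (irreducible irr)              = inj₁ (CI.class f (deg⁻ df , irr))
      encode f df (factored p)                    = inj₂ (inj₁ (index p))
      -- The content is monic, so a scalar between representatives falls on the primitive part. The
      -- class of `lower u • g` thus determines `lower u`, and the recorded constant term restores
      -- `u`.
      encode f df (imprimitive d u g mu prim f≃) = inj₂ (inj₂ (E.to (coeff u (0 ∷ [])) ,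
        CN′.class (lower u • g) (deg⁻ (Deg-lower mu (Deg-resp-≃ f≃ df)))))

      to-injective : ∀ {a b} → E.to a ≡ E.to b → a ≈ b
      to-injective {a} {b} eq =
        trans (sym (E.strictlyInverseʳ a)) (trans (E.from-cong eq) (E.strictlyInverseʳ b))

      from-injective : ∀ {i j} → E.from i ≈ E.from j → i ≡ j
      from-injective {i} {j} eq =
        ≡.trans (≡.sym (E.strictlyInverseˡ i)) (≡.trans (E.to-cong eq) (E.strictlyInverseˡ j))

      encode-injective : ∀ {f g} (df : Deg m f) (dg : Deg m g) (cf : Class f) (cg : Class g) →
                         encode f df cf ≡ encode g dg cg → f ≅ g
      encode-injective df dg (irreducible _) (irreducible _) eq =
        CI.class-injective (inj₁-injective eq)
      encode-injective {f} {g} df dg (factored p) (factored p′) eq = ≃⇒≅ (R.trans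
        (≡.subst (λ i → f ≃ List.lookup (products m) i) (inj₁-injective (inj₂-injective eq))
          (ListAny.lookup-index p))
        (R.sym (ListAny.lookup-index p′)))
      encode-injective {f} {g} df dg (imprimitive d u h mu prim f≃)
        (imprimitive d′ u′ h′ mu′ prim′ g≃) eq =
        let (u₀≡ , class≡) = ,-injective (inj₂-injective (inj₂-injective eq))
            (lu≃ , h≅) = decomposition-unique-≅ (monic-lower mu) (monic-lower mu′) prim prim′
                           (Deg⇒Nonzero (Deg-lower mu (Deg-resp-≃ f≃ df)))
                             (CN′.class-injective class≡)
        in ≅-trans (≃⇒≅ f≃)
             (≅-trans (•-≅ (lower-injective {u} {u′} (to-injective u₀≡) lu≃) h≅) (≅-sym (≃⇒≅ g≃)))

      N≤ : N ≤ I ℕ.+ (length (products m) ℕ.+ q ℕ.* N′)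
      N≤ = Fin.injective⇒≤ {f = λ i → Inverse.to numbering (code i)} λ eq →
        code-injective (Injection.injective (↔⇒↣ numbering) eq)
        where
        degree : ∀ i → Deg m (CN.representative i)
        degree i = deg⁺ (CN.representative-P i)
        class : ∀ i → Class (CN.representative i)
        class i = classify (CN.representative i) (degree i)
        code : Fin N → Code
        code i = encode (CN.representative i) (degree i) (class i)
        code-injective : ∀ {i j} → code i ≡ code j → i ≡ j
        code-injective {i} {j} eq = CN.representative-injective
          (encode-injective (degree i) (degree j) (class i) (class j) eq)
        numbering : Code ↔ Fin (I ℕ.+ (length (products m) ℕ.+ q ℕ.* N′))
        numbering = ↔-sym (↔-trans Fin.+↔⊎ (↔-refl ⊎-↔ (↔-trans Fin.+↔⊎ (↔-refl ⊎-↔ Fin.*↔×))))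

      raised : ∀ {f} → Fin q → Decomposition f → Poly k
      raised i (decomposition⁺ {content = u} {g} _ _ _) = raise (E.from i) u • g

      Deg-raised : ∀ {f} i → Deg (m′ ∷ʳ n) f → (D : Decomposition f) → Deg m (raised i D)
      Deg-raised i df (decomposition⁺ {d} {u} {g} mu prim f≃) =
        let (t , dg , n≡) = Deg-•⁻ m′ mu (Deg-resp-≃ f≃ df) in
        ≡.subst (λ n → Deg (m′ ∷ʳ n) (raise (E.from i) u • g)) (≡.cong suc (≡.sym n≡))
          (Deg-• m′ (monic-raise _ mu) dg)

      raised-injective : ∀ {f g i j} → Deg (m′ ∷ʳ n) f →
                         (D : Decomposition f) (D′ : Decomposition g) →
                         raised i D ≅ raised j D′ → i ≡ j × f ≅ g
      raised-injective {i = i} {j} df D@(decomposition⁺ {content = u} {h} mu prim f≃)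
        (decomposition⁺ {content = u′} mu′ prim′ g≃) eq =
        let (ru≃ , h≅) = decomposition-unique-≅ (monic-raise _ mu) (monic-raise _ mu′) prim prim′
                           (Deg⇒Nonzero (Deg-raised i df D)) eq
            (i≈j , u≃) = raise-injective {u = u} {u′} ru≃
        in from-injective i≈j , ≅-trans (≃⇒≅ f≃) (≅-trans (•-≅ u≃ h≅) (≅-sym (≃⇒≅ g≃)))

      -- The raised content has positive degree in the last variable. The primitive part keeps the
      -- positive degree m₁ in the first variable, so neither factor is a unit.
      raised-splits : ∀ {f} i → Deg (m′ ∷ʳ n) f → (D : Decomposition f) → Splits (raised i D)
      raised-splits i df (decomposition⁺ {d} {u} {g} mu prim f≃) = splits⁺
        {x = embedₚ (raise (E.from i) u)} {g} (R.refl {x = raise (E.from i) u • g})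
        (λ unit → ℕ.1+n≢0 (∷ʳ-injectiveʳ (replicate (suc r) 0) (replicate (suc r) 0)
          (≡.trans (Deg-unique (Deg-embed (monic-raise _ mu)) (Unit⇒Deg-0 unit))
            (≡.sym (replicate-∷ʳ (suc r) 0)))))
        (let (t , dg , _) = Deg-•⁻ m′ mu (Deg-resp-≃ f≃ df) in ¬Unit-Deg Fin.zero dg (0<m-head t))

      ≤N : I ℕ.+ q ℕ.* N′ ≤ N
      ≤N = Fin.injective⇒≤ {f = λ i → image (Inverse.to split i)} λ eq →
        Injection.injective (↔⇒↣ split)
          (image-injective (Inverse.to split _) (Inverse.to split _) eq)
        where
        split : Fin (I ℕ.+ q ℕ.* N′) ↔ (Fin I ⊎ (Fin q × Fin N′))
        split = ↔-trans Fin.+↔⊎ (↔-refl ⊎-↔ Fin.*↔×)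
        degree′ : ∀ j → Deg (m′ ∷ʳ n) (CN′.representative j)
        degree′ j = deg⁺ (CN′.representative-P j)
        decomp : ∀ j → Decomposition (CN′.representative j)
        decomp j = decompose (CN′.representative j) (Deg⇒Nonzero (degree′ j))
        image : Fin I ⊎ (Fin q × Fin N′) → Fin N
        image (inj₁ i)       = CN.class (CI.representative i) (proj₁ (CI.representative-P i))
        image (inj₂ (i , j)) = CN.class (raised i (decomp j))
          (deg⁻ (Deg-raised i (degree′ j) (decomp j)))
        -- For the lower bound on N the two kinds of images must be disjoint: one consists of
        -- irreducible classes, the other of visibly reducible ones.
        clash : ∀ i j l → ¬ (CI.representative i ≅ raised j (decomp l))
        clash i j l eq = ¬Irreducible∧Splits (proj₂ (CI.representative-P i))
          (Splits-resp-≅ eq (raised-splits j (degree′ l) (decomp l)))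
        image-injective : ∀ x y → image x ≡ image y → x ≡ y
        image-injective (inj₁ i) (inj₁ j) eq = ≡.cong inj₁
          (CI.representative-injective (CN.class-injective eq))
        image-injective (inj₁ i) (inj₂ (j , l)) eq = ⊥-elim (clash i j l (CN.class-injective eq))
        image-injective (inj₂ (j , l)) (inj₁ i) eq = ⊥-elim
          (clash i j l (≅-sym (CN.class-injective eq)))
        image-injective (inj₂ (i , j)) (inj₂ (i′ , j′)) eq =
          let (i≡i′ , f≅) = raised-injective (degree′ j) (decomp j) (decomp j′) (CN.class-injective eq)
          in ≡.cong inj₂ (≡.cong₂ _,_ i≡i′ (CN′.representative-injective f≅))

-- The integer estimate with an explicit constant

open import Data.Integer.Base as ℤ using (+_; _-_; ∣_∣)
import Data.Integer.Properties as ℤ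
import Data.Integer.Tactic.RingSolver as ℤ
open import Data.Nat.Base using (_+_; _*_; _∸_; >-nonZero; nonTrivial⇒n>1)
open import Data.Nat.Properties
open import Relation.Binary.PropositionalEquality using (refl; sym; trans; cong; subst)

primePower⇒2≤ : ∀ {q} → IsPrimePower q → 2 ≤ q
primePower⇒2≤ (p , suc r , p-prime , _ , refl) = ≤-trans 2≤p
  (m≤m*n p (p ^ r) {{m^n≢0 p r {{>-nonZero (<⇒≤ 2≤p)}}}})
  where
  2≤p : 2 ≤ p
  2≤p = nonTrivial⇒n>1 p {{prime⇒nonTrivial p-prime}}

All-∷ʳ⁻ : ∀ {a p} {A : Set a} {P : A → Set p} {n} {v : Vec A n} {x} → All P (v ∷ʳ x) → All P v × P x
All-∷ʳ⁻ {v = []}    (px ∷ []) = [] , px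
All-∷ʳ⁻ {v = _ ∷ _} (py ∷ ps) = let (pv , px) = All-∷ʳ⁻ ps in py ∷ pv , px

-- Here r = k - 2. For k = 2 the volume is m₁ ≥ 3, for k = 3 it is at least 2 · 2, and for k ≥ 4 at
-- least 1 · 2 · 2.
3≤volume : ∀ {r} m₁ (ms : Vec ℕ r) → 0 < m₁ → All (0 <_) ms → (r ≡ 0 → 3 ≤ m₁) → (r ≡ 1 → 2 ≤ m₁) →
           3 ≤ m₁ * boxSize ms
3≤volume m₁ [] _ _ 3≤m₁ _ = ≤-trans (3≤m₁ refl) (≤-reflexive (sym (*-identityʳ m₁)))
3≤volume m₁ (x ∷ []) _ (0<x ∷ []) _ 2≤m₁ = ≤-trans (s≤s (s≤s (s≤s z≤n)))
  (*-mono-≤ (2≤m₁ refl) (*-mono-≤ (s≤s 0<x) (≤-refl {1})))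
3≤volume m₁ (x ∷ y ∷ ms) 0<m₁ (0<x ∷ 0<y ∷ _) _ _ = ≤-trans (s≤s (s≤s (s≤s z≤n)))
  (*-mono-≤ 0<m₁ (*-mono-≤ (s≤s 0<x) (*-mono-≤ (s≤s 0<y) (1≤boxSize ms))))

-- Writing N = I + X + t turns the deviation into -t, and the second hypothesis says t ≤ L.
∣deviation∣≤ : ∀ {I N X L} → I + X ≤ N → N ≤ I + (L + X) → ∣ + I - (+ N - + X) ∣ ≤ L
∣deviation∣≤ {I} {N} {X} {L} I+X≤N N≤ =
  subst (λ N → ∣ + I - (+ N - + X) ∣ ≤ L) (m+[n∸m]≡n I+X≤N)
    (≤-trans (≤-reflexive (trans (cong ∣_∣ (identity (+ I) (+ X) (+ t))) (ℤ.∣-i∣≡∣i∣ (+ t)))) t≤L)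
  where
  t = N ∸ (I + X)
  identity : ∀ i x t → i - ((i ℤ.+ x ℤ.+ t) - x) ≡ ℤ.- t
  identity = ℤ.solve-∀
  regroup : ∀ i x l → i + (l + x) ≡ i + x + l
  regroup = solve-∀
  t≤L : t ≤ L
  t≤L = ≤-trans (∸-monoˡ-≤ (I + X) (≤-trans N≤ (≤-reflexive (regroup I X L))))
    (≤-reflexive (m+n∸m≡n (I + X) L))

theorem5p4 : ∀ {c ℓ} (q : ℕ) → IsPrimePower q →
    ∀ (k r : ℕ) → k ≡ 2 + r →
    ∃[ C ] 0 < C ×
    (∀ (F : FiniteField c ℓ q) (m₁ : ℕ) (ms : Vec ℕ r) (mₖ : ℕ) →
    All (0 <_) ((m₁ ∷ ms) ∷ʳ mₖ) →
    m₁ ≡ maximum (m₁ ∷ ms) →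
    (k ≡ 2 → 3 ≤ m₁) →
    (k ≡ 3 → 2 ≤ m₁) →
    ∃[ I ] ∃[ N ] ∃[ N′ ]
    IsI F ((m₁ ∷ ms) ∷ʳ mₖ) I ×
    IsN F ((m₁ ∷ ms) ∷ʳ mₖ) N ×
    IsN F ((m₁ ∷ ms) ∷ʳ (mₖ ∸ 1)) N′ ×
    ∣ + I - (+ N - + (q * N′)) ∣ ≤ C * q ^ (m₁ * product (map suc (ms ∷ʳ mₖ))))
theorem5p4 q isPrimePower k r refl = 2 ^ (2 + r) * q ^ 4 , 0<C , estimate
  where
  2≤q : 2 ≤ q
  2≤q = primePower⇒2≤ isPrimePower
  -- The constant collects a factor 2 for the geometric series of each of the 2 + r variables, and q
  -- ^ 4 from the additive 4 in the exponent.
  0<C : 0 < 2 ^ (2 + r) * q ^ 4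
  0<C = *-mono-≤ (m^n>0 2 (2 + r)) (m^n>0 q {{>-nonZero (<⇒≤ 2≤q)}} 4)
  estimate : ∀ F m₁ ms mₖ → _
  estimate F m₁ ms mₖ positive m₁≡max 3≤m₁ 2≤m₁ with All-∷ʳ⁻ {v = m₁ ∷ ms} positive
  -- Positivity of the last degree makes it a successor, so the truncated `mₖ ∸ 1` is the true
  -- predecessor `n`.
  estimate F m₁ ms (suc n) positive m₁≡max 3≤m₁ 2≤m₁ | 0<m₁ ∷ 0<ms , _ =
    let (I , isI)   = count-I m Fin.zero 0<m₁
        (N , isN)   = count-N m
        (N′ , isN′) = count-N ((m₁ ∷ ms) ∷ʳ n)
    in I , N , N′ , isI , isN , isN′ , bounded isI isN isN′
    where
    open OverFiniteField F
    open Counting (m₁ ∷ ms) 0<m₁ n hiding (k)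
    M = m₁ * boxSize (ms ∷ʳ suc n)
    open ≤-Reasoning
    bounded : ∀ {I N N′} → IsI F m I → IsN F m N → IsN F ((m₁ ∷ ms) ∷ʳ n) N′ →
              ∣ + I - (+ N - + (q * N′)) ∣ ≤ 2 ^ (2 + r) * q ^ 4 * q ^ M
    bounded {I} {N} {N′} isI isN isN′ = begin
      ∣ + I - (+ N - + (q * N′)) ∣       ≤⟨ ∣deviation∣≤ {I} {N} {q * N′} (≤N isI isN isN′)
        (N≤ isI isN isN′) ⟩
      length (products m)                ≤⟨ length-products m₁ ms (suc n) 2≤q (s≤s z≤n)
                                              (subst (λ K → All (_≤ K) (m₁ ∷ ms)) (sym m₁≡max)
                                                (All-≤-maximum (m₁ ∷ ms)))
                                              (3≤volume m₁ ms 0<m₁ 0<ms (λ { refl → 3≤m₁ refl })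
                                                (λ { refl → 2≤m₁ refl })) ⟩
      2 ^ (2 + r) * q ^ (M + 4)          ≡⟨ cong (2 ^ (2 + r) *_) (^-distribˡ-+-* q M 4) ⟩
      2 ^ (2 + r) * (q ^ M * q ^ 4)      ≡⟨ cong (2 ^ (2 + r) *_) (*-comm (q ^ M) (q ^ 4)) ⟩
      2 ^ (2 + r) * (q ^ 4 * q ^ M)      ≡⟨ *-assoc (2 ^ (2 + r)) (q ^ 4) (q ^ M) ⟨
      2 ^ (2 + r) * q ^ 4 * q ^ M        ∎
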